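{- Let $G$ be a $d$-regular graph and let $\mathrm{Ev}_\ell$ denote the number of totally even closed non-backtracking walks of length $\ell$ in $G$. Then $\mathrm{Ev}_\ell=\mathbb E_\sigma\operatorname{tr}(B_\sigma^\ell)$, the average over all signings $\sigma\in\{\pm1\}^E$. Moreover, for even $\ell$, the doubling map $w\mapsto w^2$ injects closed non-backtracking walks of length $\ell/2$ into totally even closed non-backtracking walks of length $\ell$, so $$\mathrm{Ev}_\ell\ge\operatorname{tr}(B^{\ell/2})$$ and $$\liminf_{\ell\to\infty,\ \ell\text{ even}}\mathrm{Ev}_\ell^{1/\ell}\ge\rho(B)^{1/2}=\sqrt{d-1}.$$
   Context: $G=(V,E)$ is a finite simple connected graph. The signed non-backtracking operator $B_\sigma$ acts on the $2|E|$ directed edges: $(B_\sigma)_{e,f}=\sigma_f$ if the head of $e$ is the tail of $f$ and $f\ne\bar e$ ($\bar e$ the reversal of $e$; a directed edge carries the sign of its underlying edge), and $0$ otherwise; $B$ is the case $\sigma\equiv1$, and $\rho(B)$ is its spectral radius. A closed non-backtracking walk of length $\ell$ is a sequence of directed edges $(e_1,\dots,e_\ell)$ with head of $e_i$ equal to tail of $e_{i+1}$ and $e_{i+1}\ne\bar e_i$ for all $i$ modulo $\ell$ (the starting directed edge is marked); $w^2$ is $w$ traversed twice. It is totally even if every (undirected) edge is traversed an even number of times.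
   Formalization: The liminf inequality is proved only for d ≠ 2: for d = 2 the graph is a cycle C_n, where Ev_ℓ = 0 unless 2n divides ℓ, so the liminf is 0 < 1. The spectral part assumes d ≥ 1, since √(d−1) and ρ(B) are undefined for d = 0. -}

module Defs where

open import Level using (0ℓ)
open import Algebra.Bundles.Raw using (RawRing)
import Algebra.Definitions.RawSemiring as RawSemiringOps
open import Data.Bool.Base using (Bool; true; false; not; if_then_else_)
import Data.Bool.Properties as Bool
open import Data.Fin.Base as Fin using (Fin; toℕ)
import Data.Fin.Properties as Fin
open import Data.Integer.Base as ℤ using (ℤ; +_; 0ℤ; 1ℤ; _◃_)
open import Data.List.Base using (List; []; _∷_; map; foldr; filter; length; allFin; cartesianProduct; cartesianProductWith)
open import Data.Nat.Base as ℕ using (ℕ; zero; suc)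
open import Data.Nat.DivMod using (_mod_)
open import Data.Nat.Divisibility using (_∣_; _∣?_)
import Data.Nat.Properties as ℕ
open import Data.Product.Base using (_×_; _,_; proj₁; proj₂; Σ-syntax; ∃-syntax)
open import Data.Product.Properties using (≡-dec)
open import Data.Rational.Base as ℚ using (ℚ; 0ℚ; 1ℚ; Positive; positive; nonNegative; 1/_)
import Data.Rational.Properties as ℚ
open import Data.Rational.Solver using (module +-*-Solver)
open import Data.Sign.Base using (Sign)
open import Data.Vec.Base as Vec using (Vec; lookup; count; replicate)
open import Function.Definitions using (Injective)
open import Relation.Binary.Construct.Closure.ReflexiveTransitive using (Star)
open import Relation.Binary.Definitions using (DecidableEquality)
open import Relation.Binary.PropositionalEquality using (_≡_; refl; cong; subst; sym; trans)
open import Relation.Nullary using (¬_; Dec; does; _×-dec_; ¬?)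

-- Real numbers: Cauchy sequences of rationals with a modulus, considered
-- up to the equivalence _≈ᴿ_.

record ℝ : Set where
  field
    seq    : ℕ → ℚ
    cauchy : ∀ ε → 0ℚ ℚ.< ε → ∃[ N ] ∀ m n → N ℕ.≤ m → N ℕ.≤ n →
             ℚ.∣ seq m ℚ.- seq n ∣ ℚ.≤ ε
open ℝ public

infix 4 _≈ᴿ_ _≤ᴿ_ _<ᴿ_

_≈ᴿ_ _≤ᴿ_ _<ᴿ_ : ℝ → ℝ → Set
x ≈ᴿ y = ∀ ε → 0ℚ ℚ.< ε → ∃[ N ] ∀ n → N ℕ.≤ n → ℚ.∣ seq x n ℚ.- seq y n ∣ ℚ.≤ ε
x ≤ᴿ y = ∀ ε → 0ℚ ℚ.< ε → ∃[ N ] ∀ n → N ℕ.≤ n → seq x n ℚ.≤ seq y n ℚ.+ ε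
x <ᴿ y = ∃[ ε ] 0ℚ ℚ.< ε × ∃[ N ] ∀ n → N ℕ.≤ n → seq x n ℚ.+ ε ℚ.≤ seq y n

fromℚ : ℚ → ℝ
fromℚ q .seq _ = q
fromℚ q .cauchy ε 0<ε = 0 , λ _ _ _ _ →
  subst (ℚ._≤ ε) (sym (cong ℚ.∣_∣ (ℚ.+-inverseʳ q))) (ℚ.<⇒≤ 0<ε)

fromℤ : ℤ → ℝ
fromℤ i = fromℚ (i ℚ./ 1)

fromℕ : ℕ → ℝ
fromℕ n = fromℤ (+ n)

private
  halve : ∀ ε → 0ℚ ℚ.< ε → ∃[ δ ] 0ℚ ℚ.< δ × δ ℚ.+ δ ≡ ε
  halve ε 0<ε = ℚ.½ ℚ.* ε ,
    subst (ℚ._< ℚ.½ ℚ.* ε) (ℚ.*-zeroʳ ℚ.½) (ℚ.*-monoʳ-<-pos ℚ.½ 0<ε) ,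
    trans (sym (ℚ.*-distribʳ-+ ε ℚ.½ ℚ.½)) (ℚ.*-identityˡ ε)

  eventually-bounded : ∀ x → ∃[ K ] 0ℚ ℚ.< K × ∃[ N ] ∀ n → N ℕ.≤ n → ℚ.∣ seq x n ∣ ℚ.≤ K
  eventually-bounded x with cauchy x 1ℚ (ℚ.positive⁻¹ 1ℚ)
  ... | N , close = 1ℚ ℚ.+ ℚ.∣ seq x N ∣ ,
    ℚ.+-mono-<-≤ (ℚ.positive⁻¹ 1ℚ) (ℚ.0≤∣p∣ (seq x N)) , N , λ n N≤n → begin
      ℚ.∣ seq x n ∣                                   ≡⟨ cong ℚ.∣_∣ (split (seq x n) (seq x N)) ⟩
      ℚ.∣ (seq x n ℚ.- seq x N) ℚ.+ seq x N ∣         ≤⟨ ℚ.∣p+q∣≤∣p∣+∣q∣ (seq x n ℚ.- seq x N) (seq x N) ⟩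
      ℚ.∣ seq x n ℚ.- seq x N ∣ ℚ.+ ℚ.∣ seq x N ∣     ≤⟨ ℚ.+-monoˡ-≤ ℚ.∣ seq x N ∣ (close n N N≤n ℕ.≤-refl) ⟩
      1ℚ ℚ.+ ℚ.∣ seq x N ∣                            ∎
    where
    open ℚ.≤-Reasoning
    open +-*-Solver
    split : ∀ a b → a ≡ (a ℚ.- b) ℚ.+ b
    split = solve 2 (λ a b → a := (a :- b) :+ b) refl

infixl 6 _+ᴿ_
infixl 7 _*ᴿ_
infix  8 -ᴿ_

_+ᴿ_ : ℝ → ℝ → ℝ
(x +ᴿ y) .seq n = seq x n ℚ.+ seq y n
(x +ᴿ y) .cauchy ε 0<ε with halve ε 0<ε
... | δ , 0<δ , refl with cauchy x δ 0<δ | cauchy y δ 0<δ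
... | N , closeˣ | N′ , closeʸ = N ℕ.⊔ N′ , λ m n ≤m ≤n → begin
  ℚ.∣ (seq x m ℚ.+ seq y m) ℚ.- (seq x n ℚ.+ seq y n) ∣
    ≡⟨ cong ℚ.∣_∣ (regroup (seq x m) (seq y m) (seq x n) (seq y n)) ⟩
  ℚ.∣ (seq x m ℚ.- seq x n) ℚ.+ (seq y m ℚ.- seq y n) ∣
    ≤⟨ ℚ.∣p+q∣≤∣p∣+∣q∣ (seq x m ℚ.- seq x n) (seq y m ℚ.- seq y n) ⟩
  ℚ.∣ seq x m ℚ.- seq x n ∣ ℚ.+ ℚ.∣ seq y m ℚ.- seq y n ∣
    ≤⟨ ℚ.+-mono-≤ (closeˣ m n (ℕ.m⊔n≤o⇒m≤o N N′ ≤m) (ℕ.m⊔n≤o⇒m≤o N N′ ≤n))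
                  (closeʸ m n (ℕ.m⊔n≤o⇒n≤o N N′ ≤m) (ℕ.m⊔n≤o⇒n≤o N N′ ≤n)) ⟩
  δ ℚ.+ δ ∎
  where
  open ℚ.≤-Reasoning
  open +-*-Solver
  regroup : ∀ a b c d → (a ℚ.+ b) ℚ.- (c ℚ.+ d) ≡ (a ℚ.- c) ℚ.+ (b ℚ.- d)
  regroup = solve 4 (λ a b c d → (a :+ b) :- (c :+ d) := (a :- c) :+ (b :- d)) refl

-ᴿ_ : ℝ → ℝ
(-ᴿ x) .seq n = ℚ.- seq x n
(-ᴿ x) .cauchy ε 0<ε with cauchy x ε 0<ε
... | N , close = N , λ m n N≤m N≤n →
  subst (ℚ._≤ ε) (cong ℚ.∣_∣ (flip (seq x m) (seq x n))) (close n m N≤n N≤m)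
  where
  open +-*-Solver
  flip : ∀ a b → b ℚ.- a ≡ (ℚ.- a) ℚ.- (ℚ.- b)
  flip = solve 2 (λ a b → b :- a := (:- a) :- (:- b)) refl

private
  module _ where
    open ℚ.≤-Reasoning
    open +-*-Solver

    ∣p*q∣≤ : ∀ p q a b → ℚ.∣ p ∣ ℚ.≤ a → ℚ.∣ q ∣ ℚ.≤ b → ℚ.∣ p ℚ.* q ∣ ℚ.≤ a ℚ.* b
    ∣p*q∣≤ p q a b p≤a q≤b = begin
      ℚ.∣ p ℚ.* q ∣         ≡⟨ ℚ.∣p*q∣≡∣p∣*∣q∣ p q ⟩
      ℚ.∣ p ∣ ℚ.* ℚ.∣ q ∣   ≤⟨ ℚ.*-monoʳ-≤-nonNeg ℚ.∣ q ∣ {{nonNegative (ℚ.0≤∣p∣ q)}} p≤a ⟩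
      a ℚ.* ℚ.∣ q ∣         ≤⟨ ℚ.*-monoˡ-≤-nonNeg a {{nonNegative (ℚ.≤-trans (ℚ.0≤∣p∣ p) p≤a)}} q≤b ⟩
      a ℚ.* b               ∎

    divide : ∀ K ε → 0ℚ ℚ.< K → 0ℚ ℚ.< ε → ∃[ δ ] 0ℚ ℚ.< δ × K ℚ.* δ ≡ ε
    divide K ε 0<K 0<ε = 1/ K ℚ.* ε ,
      ℚ.positive⁻¹ (1/ K ℚ.* ε)
        {{ℚ.pos*pos⇒pos (1/ K) {{ℚ.1/pos⇒pos K}} ε {{positive 0<ε}}}} ,
      trans (sym (ℚ.*-assoc K (1/ K) ε))
        (trans (cong (ℚ._* ε) (ℚ.*-inverseʳ K)) (ℚ.*-identityˡ ε))
      where instance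
        K-pos : Positive K
        K-pos = positive 0<K
        K-nonZero : ℚ.NonZero K
        K-nonZero = ℚ.pos⇒nonZero K

    product-close : ∀ a b c d {K L δ} →
      ℚ.∣ a ∣ ℚ.≤ K → ℚ.∣ d ∣ ℚ.≤ L → ℚ.∣ a ℚ.- c ∣ ℚ.≤ δ → ℚ.∣ b ℚ.- d ∣ ℚ.≤ δ →
      ℚ.∣ a ℚ.* b ℚ.- c ℚ.* d ∣ ℚ.≤ (K ℚ.+ L) ℚ.* δ
    product-close a b c d {K} {L} {δ} a≤K d≤L a~c b~d = begin
      ℚ.∣ a ℚ.* b ℚ.- c ℚ.* d ∣
        ≡⟨ cong ℚ.∣_∣ (regroup a b c d) ⟩
      ℚ.∣ a ℚ.* (b ℚ.- d) ℚ.+ (a ℚ.- c) ℚ.* d ∣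
        ≤⟨ ℚ.∣p+q∣≤∣p∣+∣q∣ (a ℚ.* (b ℚ.- d)) ((a ℚ.- c) ℚ.* d) ⟩
      ℚ.∣ a ℚ.* (b ℚ.- d) ∣ ℚ.+ ℚ.∣ (a ℚ.- c) ℚ.* d ∣
        ≤⟨ ℚ.+-mono-≤ (∣p*q∣≤ a (b ℚ.- d) K δ a≤K b~d) (∣p*q∣≤ (a ℚ.- c) d δ L a~c d≤L) ⟩
      K ℚ.* δ ℚ.+ δ ℚ.* L
        ≡⟨ cong (K ℚ.* δ ℚ.+_) (ℚ.*-comm δ L) ⟩
      K ℚ.* δ ℚ.+ L ℚ.* δ
        ≡⟨ sym (ℚ.*-distribʳ-+ δ K L) ⟩
      (K ℚ.+ L) ℚ.* δ ∎
      where
      regroup : ∀ a b c d → a ℚ.* b ℚ.- c ℚ.* d ≡ a ℚ.* (b ℚ.- d) ℚ.+ (a ℚ.- c) ℚ.* d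
      regroup = solve 4 (λ a b c d → a :* b :- c :* d := a :* (b :- d) :+ (a :- c) :* d) refl

    ⊔₄ : ∀ a b c d {n} → (a ℕ.⊔ b) ℕ.⊔ (c ℕ.⊔ d) ℕ.≤ n → (a ℕ.≤ n × b ℕ.≤ n) × (c ℕ.≤ n × d ℕ.≤ n)
    ⊔₄ a b c d ≤n =
      (ℕ.m⊔n≤o⇒m≤o a b l , ℕ.m⊔n≤o⇒n≤o a b l) , (ℕ.m⊔n≤o⇒m≤o c d r , ℕ.m⊔n≤o⇒n≤o c d r)
      where
      l = ℕ.m⊔n≤o⇒m≤o (a ℕ.⊔ b) (c ℕ.⊔ d) ≤n
      r = ℕ.m⊔n≤o⇒n≤o (a ℕ.⊔ b) (c ℕ.⊔ d) ≤n

_*ᴿ_ : ℝ → ℝ → ℝ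
(x *ᴿ y) .seq n = seq x n ℚ.* seq y n
(x *ᴿ y) .cauchy ε 0<ε =
  let K , 0<K , M  , boundˣ = eventually-bounded x
      L , 0<L , M′ , boundʸ = eventually-bounded y
      δ , 0<δ , Kδ≡ε = divide (K ℚ.+ L) ε (ℚ.+-mono-< 0<K 0<L) 0<ε
      Q  , closeˣ = cauchy x δ 0<δ
      Q′ , closeʸ = cauchy y δ 0<δ
  in (M ℕ.⊔ M′) ℕ.⊔ (Q ℕ.⊔ Q′) , λ m n ≤m ≤n →
    let (M≤m , _) , (Q≤m , Q′≤m) = ⊔₄ M M′ Q Q′ ≤m
        (_ , M′≤n) , (Q≤n , Q′≤n) = ⊔₄ M M′ Q Q′ ≤n
    in subst (_ ℚ.≤_) Kδ≡ε
         (product-close (seq x m) (seq y m) (seq x n) (seq y n)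
           (boundˣ m M≤m) (boundʸ n M′≤n) (closeˣ m n Q≤m Q≤n) (closeʸ m n Q′≤m Q′≤n))

ℝ-rawRing : RawRing 0ℓ 0ℓ
ℝ-rawRing = record
  { Carrier = ℝ ; _≈_ = _≈ᴿ_ ; _+_ = _+ᴿ_ ; _*_ = _*ᴿ_ ; -_ = -ᴿ_
  ; 0# = fromℕ 0 ; 1# = fromℕ 1 }

open RawSemiringOps (RawRing.rawSemiring ℝ-rawRing) public using () renaming (_^_ to _^ᴿ_)

-- For k ≥ 1: y is the non-negative k-th root of x.
IsRoot : ℕ → ℝ → ℝ → Set
IsRoot k x y = fromℕ 0 ≤ᴿ y × y ^ᴿ k ≈ᴿ x

-- c ≤ lim inf of a(ℓ) as ℓ → ∞ through the even numbers.  The lower limit is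
-- sup_N inf {a(ℓ) : ℓ ≥ N, ℓ even} in the extended reals, which need not be
-- computable as a real number, so the inequality is spelled out: every q < c
-- is a lower bound of some tail.
_≤liminfᵉᵛᵉⁿ_ : ℝ → (ℕ → ℝ) → Set
c ≤liminfᵉᵛᵉⁿ a = ∀ q → q <ᴿ c → ∃[ N ] ∀ ℓ → N ℕ.≤ ℓ → 2 ∣ ℓ → q ≤ᴿ a ℓ

record ℂ : Set where
  constructor _+i_
  field
    re im : ℝ
open ℂ public

ℂ-rawRing : RawRing 0ℓ 0ℓ
ℂ-rawRing = record
  { Carrier = ℂ
  ; _≈_ = λ z w → re z ≈ᴿ re w × im z ≈ᴿ im w
  ; _+_ = λ z w → (re z +ᴿ re w) +i (im z +ᴿ im w)
  ; _*_ = λ z w → (re z *ᴿ re w +ᴿ -ᴿ (im z *ᴿ im w)) +i (re z *ᴿ im w +ᴿ im z *ᴿ re w)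
  ; -_  = λ z → (-ᴿ re z) +i (-ᴿ im z)
  ; 0#  = fromℕ 0 +i fromℕ 0
  ; 1#  = fromℕ 1 +i fromℕ 0
  }

∣_∣² : ℂ → ℝ
∣ z ∣² = re z *ᴿ re z +ᴿ im z *ᴿ im z

ℤ→ℂ : ℤ → ℂ
ℤ→ℂ i = fromℤ i +i fromℕ 0

module Sum {c ℓ} (R : RawRing c ℓ) where
  open RawRing R

  ∑ : {A : Set} → List A → (A → Carrier) → Carrier
  ∑ xs f = foldr _+_ 0# (map f xs)

-- Integer matrices with rows and columns indexed by X, whose elements are
-- listed, without repetition, by xs.
module Matrices {X : Set} (xs : List X) (_≟_ : DecidableEquality X) where

  Matrix : Set
  Matrix = X → X → ℤ

  open Sum ℤ.+-*-rawRing

  identity : Matrix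
  identity x y = if does (x ≟ y) then 1ℤ else 0ℤ

  _⊗_ : Matrix → Matrix → Matrix
  (A ⊗ C) x y = ∑ xs (λ z → A x z ℤ.* C z y)

  _^ᴹ_ : Matrix → ℕ → Matrix
  A ^ᴹ zero  = identity
  A ^ᴹ suc k = A ⊗ (A ^ᴹ k)

  tr : Matrix → ℤ
  tr A = ∑ xs (λ x → A x x)

  IsEigenvalue : Matrix → ℂ → Set
  IsEigenvalue A z = Σ[ v ∈ (X → ℂ) ] ¬ (∀ x → v x ≈ 0#) ×
    (∀ x → Sum.∑ ℂ-rawRing xs (λ y → ℤ→ℂ (A x y) * v y) ≈ z * v x)
    where open RawRing ℂ-rawRing

  -- r = max {∣z∣ : z eigenvalue of A}; since r ≥ 0, the relations ∣z∣ = r and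
  -- ∣z∣ ≤ r are stated between squares.
  IsSpectralRadius : Matrix → ℝ → Set
  IsSpectralRadius A r =
    fromℕ 0 ≤ᴿ r ×
    (∃[ z ] IsEigenvalue A z × ∣ z ∣² ≈ᴿ r *ᴿ r) ×
    (∀ z → IsEigenvalue A z → ∣ z ∣² ≤ᴿ r *ᴿ r)

-- A finite simple graph with numbered vertices and edges.  Each edge is
-- recorded once, smaller endpoint first, so there are no loops, and `ends`
-- being injective excludes parallel edges.
record Graph : Set where
  field
    ∣V∣ ∣E∣  : ℕ
    ends     : Fin ∣E∣ → Fin ∣V∣ × Fin ∣V∣
    ordered  : ∀ i → proj₁ (ends i) Fin.< proj₂ (ends i)
    simple   : Injective _≡_ _≡_ ends

-- All vectors of length n over the list xs, each listed once if xs has no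
-- repetitions.
vectors : {A : Set} → List A → ∀ n → List (Vec A n)
vectors xs zero    = Vec.[] ∷ []
vectors xs (suc n) = cartesianProductWith Vec._∷_ xs (vectors xs n)

cyclicSuc : ∀ {n} → Fin n → Fin n
cyclicSuc {suc n} i = suc (toℕ i) mod suc n

module NonBacktracking (G : Graph) where
  open Graph G

  -- A directed edge is an edge with an orientation; `false` directs it from
  -- its smaller endpoint to its larger one.
  DirectedEdge : Set
  DirectedEdge = Fin ∣E∣ × Bool

  edge : DirectedEdge → Fin ∣E∣
  edge = proj₁

  rev : DirectedEdge → DirectedEdge
  rev (i , b) = i , not b

  tail head : DirectedEdge → Fin ∣V∣
  tail (i , false) = proj₁ (ends i)
  tail (i , true)  = proj₂ (ends i)
  head e = tail (rev e)

  directedEdges : List DirectedEdge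
  directedEdges = cartesianProduct (allFin ∣E∣) (false ∷ true ∷ [])

  _≟ᴰ_ : DecidableEquality DirectedEdge
  _≟ᴰ_ = ≡-dec Fin._≟_ Bool._≟_

  Connected : Set
  Connected = ℕ.NonZero ∣V∣ ×
    (∀ u v → Star (λ x y → ∃[ e ] tail e ≡ x × head e ≡ y) u v)

  degree : Fin ∣V∣ → ℕ
  degree v = length (filter (λ e → tail e Fin.≟ v) directedEdges)

  Regular : ℕ → Set
  Regular d = ∀ v → degree v ≡ d

  _⇝_ : DirectedEdge → DirectedEdge → Set
  e ⇝ f = head e ≡ tail f × ¬ f ≡ rev e

  _⇝?_ : ∀ e f → Dec (e ⇝ f)
  e ⇝? f = (head e Fin.≟ tail f) ×-dec ¬? (f ≟ᴰ rev e)

  IsClosedNB : ∀ {ℓ} → Vec DirectedEdge ℓ → Set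
  IsClosedNB w = ∀ i → lookup w i ⇝ lookup w (cyclicSuc i)

  isClosedNB? : ∀ {ℓ} (w : Vec DirectedEdge ℓ) → Dec (IsClosedNB w)
  isClosedNB? w = Fin.all? (λ i → lookup w i ⇝? lookup w (cyclicSuc i))

  IsTotallyEven : ∀ {ℓ} → Vec DirectedEdge ℓ → Set
  IsTotallyEven w = ∀ i → 2 ∣ count (λ e → edge e Fin.≟ i) w

  isTotallyEven? : ∀ {ℓ} (w : Vec DirectedEdge ℓ) → Dec (IsTotallyEven w)
  isTotallyEven? w = Fin.all? (λ i → 2 ∣? count (λ e → edge e Fin.≟ i) w)

  Ev : ℕ → ℕ
  Ev ℓ = length (filter (λ w → isClosedNB? w ×-dec isTotallyEven? w) (vectors directedEdges ℓ))

  Signing : Set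
  Signing = Vec Sign ∣E∣

  𝔼σ : (Signing → ℤ) → ℚ
  𝔼σ F = ℚ._/_ (Sum.∑ ℤ.+-*-rawRing (vectors (Sign.+ ∷ Sign.- ∷ []) ∣E∣) F) (2 ℕ.^ ∣E∣)
    where instance
      2^∣E∣-nonZero : ℕ.NonZero (2 ℕ.^ ∣E∣)
      2^∣E∣-nonZero = ℕ.m^n≢0 2 ∣E∣

  open Matrices directedEdges _≟ᴰ_ public

  Bσ : Signing → Matrix
  Bσ σ e f = if does (e ⇝? f) then lookup σ (edge f) ◃ 1 else 0ℤ

  B : Matrix
  B = Bσ (replicate ∣E∣ Sign.+)

{-# OPTIONS --safe #-}

-- Expanding the trace turns 𝔼σ tr(Bσ^ℓ) into a sum over closed non-backtracking
-- walks of the average of a monomial in the signs, which is 1 if all exponents are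
-- even and 0 otherwise.
--
-- The rows and columns of B all sum to d − 1.  Hence d − 1 is an eigenvalue, with a
-- constant eigenvector, and by Schur's test ∥B v∥₂ ≤ (d − 1) ∥v∥₂ for every v.
--
-- For the lower limit the walks w² do not suffice: on a bipartite graph tr(B^(ℓ/2))
-- vanishes when ℓ/2 is odd.  Let d ≥ 3.  As ⇝ has equal in- and outdegrees, any step
-- e ⇝ f can be undone by a walk from f to e; so ⇝ is strongly connected, and there is
-- a walk that takes every step x ⇝ y.  However this walk is continued, its last edge
-- meets an earlier passage x ⇝ y from the side.  Running twice round the loop closed
-- in this way, and then back to the start, traverses every edge an even number of
-- times; a similar, fixed detour at the start closes the walk up.  This embeds the
-- (d − 1)^n continuations by n steps into the totally even closed walks of length
-- 2 (C + n), with C independent of n.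

module Submission where

open import Defs
open import Algebra.Bundles using (CommutativeRing)
open import Data.Fin.Base as Fin using (Fin)
import Data.Fin.Properties as Fin
open import Data.Integer.Base as ℤ using (ℤ; 0ℤ; 1ℤ; -1ℤ; _◃_)
import Data.Integer.Properties as ℤ
open import Data.List.Base as List using (List; []; _∷_; map; cartesianProductWith; cartesianProduct; filter; length; allFin)
open import Data.List.Membership.Propositional using (_∈_; _∉_; find; lose)
open import Data.List.Relation.Unary.Any using (here; there; any?)
open import Data.Nat.Base as ℕ using (ℕ; zero; suc)
open import Data.Nat.Divisibility using (_∣_; _∣?_; divides; ∣m∣n⇒∣m+n; ∣-refl; _∣0; m∣m*n)
import Data.Nat.Properties as ℕ
open import Data.Product.Base using (_×_; _,_; proj₁; proj₂; ∃-syntax)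
open import Data.Rational.Base as ℚ using (ℚ)
import Data.Rational.Properties as ℚ
open import Data.Sum.Base using (_⊎_; inj₁; inj₂)
open import Function.Base using (_∘_; id)
open import Relation.Binary.Definitions using (DecidableEquality)
open import Relation.Binary.PropositionalEquality hiding (setoid; J)
open import Relation.Nullary using (¬_; Dec; yes; no; does; _×-dec_; ¬?; contradiction)

-- Why the lower limit needs `d ≢ 2`: a connected 2-regular graph is a cycle of some length m ≥ 3, a
-- totally even closed walk goes round it an even number of times, and so `Ev` vanishes at every
-- even length that is not a multiple of 2m; the lower limit is 0, below the claimed bound 1. For
-- `d = 1` the bound is 0. A turn costs exactly as many edges as the walk made before it, wherever
-- the earlier passage lies on that walk. Hence all continuations by n steps close up at one common
-- length, although their detours differ, and the continuation can be read off as a prefix. The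
-- price of the fixed part is a factor (d - 1)^C, which an arbitrarily small decrease of the base
-- √(d - 1) absorbs. Reals are Cauchy sequences and their order is undecidable. Estimates are
-- therefore proved between rational terms at a fixed index and only then passed to the limit; the
-- eigenvalue bound is obtained by refuting a strict excess.

module SumProperties {c ℓ} (R : CommutativeRing c ℓ) where
  open CommutativeRing R renaming (refl to ≈-refl; sym to ≈-sym; trans to ≈-trans)
  open Sum rawRing
  open import Relation.Binary.Reasoning.Setoid setoid
  open import Algebra.Properties.CommutativeSemigroup +-commutativeSemigroup using (interchange)

  module _ {A : Set} where

    ∑-cong : (xs : List A) {f g : A → Carrier} → (∀ x → f x ≈ g x) → ∑ xs f ≈ ∑ xs g
    ∑-cong []       f≈g = ≈-refl
    ∑-cong (x ∷ xs) f≈g = +-cong (f≈g x) (∑-cong xs f≈g)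

    ∑-zero : (xs : List A) → ∑ xs (λ _ → 0#) ≈ 0#
    ∑-zero []       = ≈-refl
    ∑-zero (x ∷ xs) = ≈-trans (+-identityˡ _) (∑-zero xs)

    ∑-distrib-+ : (xs : List A) (f g : A → Carrier) → ∑ xs (λ x → f x + g x) ≈ ∑ xs f + ∑ xs g
    ∑-distrib-+ []       f g = ≈-sym (+-identityˡ _)
    ∑-distrib-+ (x ∷ xs) f g =
      ≈-trans (+-congˡ (∑-distrib-+ xs f g)) (interchange (f x) (g x) (∑ xs f) (∑ xs g))

    *-distribˡ-∑ : (xs : List A) (a : Carrier) (f : A → Carrier) → a * ∑ xs f ≈ ∑ xs (λ x → a * f x)
    *-distribˡ-∑ []       a f = zeroʳ a
    *-distribˡ-∑ (x ∷ xs) a f = ≈-trans (distribˡ a _ _) (+-congˡ (*-distribˡ-∑ xs a f))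

    *-distribʳ-∑ : (xs : List A) (a : Carrier) (f : A → Carrier) → ∑ xs f * a ≈ ∑ xs (λ x → f x * a)
    *-distribʳ-∑ xs a f = begin
      ∑ xs f * a             ≈⟨ *-comm _ a ⟩
      a * ∑ xs f             ≈⟨ *-distribˡ-∑ xs a f ⟩
      ∑ xs (λ x → a * f x)   ≈⟨ ∑-cong xs (λ x → *-comm a (f x)) ⟩
      ∑ xs (λ x → f x * a)   ∎

    ∑-++ : (xs ys : List A) (f : A → Carrier) → ∑ (xs List.++ ys) f ≈ ∑ xs f + ∑ ys f
    ∑-++ []       ys f = ≈-sym (+-identityˡ _)
    ∑-++ (x ∷ xs) ys f = ≈-trans (+-congˡ (∑-++ xs ys f)) (≈-sym (+-assoc _ _ _))

  module _ {A B : Set} where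

    ∑-map : (h : A → B) (xs : List A) (f : B → Carrier) → ∑ (map h xs) f ≈ ∑ xs (f ∘ h)
    ∑-map h []       f = ≈-refl
    ∑-map h (x ∷ xs) f = +-congˡ (∑-map h xs f)

    ∑-swap : (xs : List A) (ys : List B) (f : A → B → Carrier) →
             ∑ xs (λ x → ∑ ys (f x)) ≈ ∑ ys (λ y → ∑ xs (λ x → f x y))
    ∑-swap []       ys f = ≈-sym (∑-zero ys)
    ∑-swap (x ∷ xs) ys f = ≈-trans (+-congˡ (∑-swap xs ys f)) (≈-sym (∑-distrib-+ ys (f x) _))

  ∑-cartesianProductWith : ∀ {A B C : Set} (h : A → B → C) xs ys (f : C → Carrier) →
    ∑ (cartesianProductWith h xs ys) f ≈ ∑ xs (λ x → ∑ ys (λ y → f (h x y)))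
  ∑-cartesianProductWith h []       ys f = ≈-refl
  ∑-cartesianProductWith h (x ∷ xs) ys f = ≈-trans (∑-++ (map (h x) ys) _ f)
    (+-cong (∑-map (h x) ys f) (∑-cartesianProductWith h xs ys f))


module Combinatorics where

  open import Data.Bool.Base using (Bool; true; false; if_then_else_; _∧_)
  import Data.Bool.Properties as Bool
  open import Data.Empty using (⊥)
  open import Data.Fin.Relation.Unary.Top using (view; ‵fromℕ; ‵inject₁)
  open import Data.Integer.Base using (+_)
  import Data.List.Membership.DecPropositional as DecMembership
  open import Data.List.Membership.Propositional.Properties
    using (∈-cartesianProductWith⁺; ∈-cartesianProduct⁺; ∈-allFin; ∈-filter⁺; ∈-filter⁻; ∈-map⁻;
           ∈-∃++; ∈-++⁻; ∈-++⁺ˡ; ∈-++⁺ʳ; ∈-lookup)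
  import Data.List.Properties as List
  open import Data.List.Relation.Binary.Subset.Propositional using (_⊆_)
  open import Data.List.Relation.Unary.All as All using (All; []; _∷_)
  open import Data.List.Relation.Unary.All.Properties using (All¬⇒¬Any)
  open import Data.List.Relation.Unary.AllPairs using ([]; _∷_)
  open import Data.List.Relation.Unary.Unique.Propositional using (Unique)
  import Data.List.Relation.Unary.Unique.Propositional.Properties as Unique
  open import Data.Nat.DivMod using (_mod_; n%n≡0; m<n⇒m%n≡m)
  open import Data.Nat.Solver using (module +-*-Solver)
  open import Data.Rational.Unnormalised.Base using (mkℚᵘ; *≡*)
  open import Data.Sign.Base as Sign using (Sign)
  open import Data.Vec.Base as Vec using (Vec; []; _∷_; _∷ʳ_; lookup; toList; count)
  import Data.Vec.Properties as Vec
  open import Function.Bundles using (_⇔_; mk⇔; Equivalence)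
  open import Relation.Binary.Construct.Closure.ReflexiveTransitive using (Star; ε; _◅_)
  open import Relation.Nullary.Decidable using (does-⇔; dec-true; dec-false)

  -- Cyclic words as linear ones

  module Walk {A : Set} (_∼_ : A → A → Set) where

    -- A closed walk `x ∷ w` becomes `Linked x w x`. Naming the start again as the end makes the
    -- cyclic condition linear, so that walks can be concatenated without arithmetic modulo the
    -- length.
    Linked : A → List A → A → Set
    Linked x []       y = x ∼ y
    Linked x (z ∷ zs) y = x ∼ z × Linked z zs y

    private
      linked⇒pointwise : ∀ {n} x (w : Vec A n) {y} → Linked x (toList w) y →
                         ∀ i → lookup (x ∷ w) i ∼ lookup (w ∷ʳ y) i
      linked⇒pointwise x []      l       Fin.zero    = l
      linked⇒pointwise x (z ∷ w) (l , _) Fin.zero    = l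
      linked⇒pointwise x (z ∷ w) (_ , l) (Fin.suc i) = linked⇒pointwise z w l i

      pointwise⇒linked : ∀ {n} x (w : Vec A n) {y} →
                         (∀ i → lookup (x ∷ w) i ∼ lookup (w ∷ʳ y) i) → Linked x (toList w) y
      pointwise⇒linked x []      p = p Fin.zero
      pointwise⇒linked x (z ∷ w) p = p Fin.zero , pointwise⇒linked z w (p ∘ Fin.suc)

      lookup-∷ʳ-fromℕ : ∀ {n} (w : Vec A n) y → lookup (w ∷ʳ y) (Fin.fromℕ n) ≡ y
      lookup-∷ʳ-fromℕ []      y = refl
      lookup-∷ʳ-fromℕ (x ∷ w) y = lookup-∷ʳ-fromℕ w y

      lookup-∷ʳ-inject₁ : ∀ {n} (w : Vec A n) y i → lookup (w ∷ʳ y) (Fin.inject₁ i) ≡ lookup w i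
      lookup-∷ʳ-inject₁ (x ∷ w) y Fin.zero    = refl
      lookup-∷ʳ-inject₁ (x ∷ w) y (Fin.suc i) = lookup-∷ʳ-inject₁ w y i

      toℕ-mod : ∀ m n → Fin.toℕ (m mod suc n) ≡ m ℕ.% suc n
      toℕ-mod m n = Fin.toℕ-fromℕ< _

      cyclicSuc-fromℕ : ∀ n → cyclicSuc (Fin.fromℕ n) ≡ Fin.zero
      cyclicSuc-fromℕ n = Fin.toℕ-injective (trans (toℕ-mod (suc (Fin.toℕ (Fin.fromℕ n))) n)
        (trans (cong (λ m → suc m ℕ.% suc n) (Fin.toℕ-fromℕ n)) (n%n≡0 (suc n))))

      cyclicSuc-inject₁ : ∀ {n} (i : Fin n) → cyclicSuc (Fin.inject₁ i) ≡ Fin.suc i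
      cyclicSuc-inject₁ {n} i = Fin.toℕ-injective (trans (toℕ-mod (suc (Fin.toℕ (Fin.inject₁ i))) n)
        (trans (cong (λ m → suc m ℕ.% suc n) (Fin.toℕ-inject₁ i)) (m<n⇒m%n≡m (ℕ.s≤s (Fin.toℕ<n i)))))

      -- Both sides read the rotated word; only the last index wraps round, which is the case
      -- `‵fromℕ`.
      lookup-cyclicSuc : ∀ {n} x (w : Vec A n) i → lookup (x ∷ w) (cyclicSuc i) ≡ lookup (w ∷ʳ x) i
      lookup-cyclicSuc {n} x w i with view i
      ... | ‵fromℕ     rewrite cyclicSuc-fromℕ n   = sym (lookup-∷ʳ-fromℕ w x)
      ... | ‵inject₁ j rewrite cyclicSuc-inject₁ j = sym (lookup-∷ʳ-inject₁ w x j)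

    cyclic⇔linked : ∀ {n} x (w : Vec A n) →
      (∀ i → lookup (x ∷ w) i ∼ lookup (x ∷ w) (cyclicSuc i)) ⇔ Linked x (toList w) x
    cyclic⇔linked x w = mk⇔
      (λ p → pointwise⇒linked x w λ i → subst (lookup (x ∷ w) i ∼_) (lookup-cyclicSuc x w i) (p i))
      (λ l i → subst (lookup (x ∷ w) i ∼_) (sym (lookup-cyclicSuc x w i)) (linked⇒pointwise x w l i))

    linked-++⁺ : ∀ {x} xs {y} ys {z} → Linked x xs y → Linked y ys z → Linked x (xs List.++ y ∷ ys) z
    linked-++⁺ []       ys l       l′ = l , l′
    linked-++⁺ (_ ∷ xs) ys (l , m) l′ = l , linked-++⁺ xs ys m l′

    linked-++⁻ : ∀ {x} xs {y} ys {z} → Linked x (xs List.++ y ∷ ys) z → Linked x xs y × Linked y ys z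
    linked-++⁻ []       ys (l , l′) = l , l′
    linked-++⁻ (_ ∷ xs) ys (l , l′) = let m , m′ = linked-++⁻ xs ys l′ in (l , m) , m′

  open SumProperties ℤ.+-*-commutativeRing
  open Sum ℤ.+-*-rawRing

  ∑-filter : {A : Set} {P : A → Set} (P? : ∀ x → Dec (P x)) (xs : List A) (c : ℤ) →
             ∑ xs (λ x → if does (P? x) then c else 0ℤ) ≡ + length (filter P? xs) ℤ.* c
  ∑-filter P? []       c = sym (ℤ.*-zeroˡ c)
  ∑-filter P? (x ∷ xs) c with does (P? x)
  ... | true  = trans (cong (ℤ._+_ c) (∑-filter P? xs c)) (sym (ℤ.suc-* (+ length (filter P? xs)) c))
  ... | false = trans (ℤ.+-identityˡ _) (∑-filter P? xs c)

  -- Traces of matrix powers as sums over words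

  module MatrixPowers {X : Set} (xs : List X) (_≟_ : DecidableEquality X)
    (unique : Unique xs) (complete : ∀ x → x ∈ xs) where

    open Matrices xs _≟_
    open ≡-Reasoning

    private
      ∑-identity-∉ : ∀ (f : X → ℤ) {y} ys → y ∉ ys → ∑ ys (λ z → f z ℤ.* identity z y) ≡ 0ℤ
      ∑-identity-∉ f     []       y∉ = refl
      ∑-identity-∉ f {y} (z ∷ ys) y∉ with z ≟ y
      ... | yes refl = contradiction (here refl) y∉
      ... | no  _    = cong₂ ℤ._+_ (ℤ.*-zeroʳ (f z)) (∑-identity-∉ f ys (y∉ ∘ there))

      ∑-identity : ∀ (f : X → ℤ) {y ys} → Unique ys → y ∈ ys → ∑ ys (λ z → f z ℤ.* identity z y) ≡ f y
      ∑-identity f {y} {z ∷ ys} (z∉ ∷ _) y∈ with z ≟ y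
      ... | yes refl = trans (cong₂ ℤ._+_ (ℤ.*-identityʳ (f z)) (∑-identity-∉ f ys (All¬⇒¬Any z∉)))
                             (ℤ.+-identityʳ (f z))
      ∑-identity f {y} {z ∷ ys} (_ ∷ _) (here refl)   | no z≢y = contradiction refl z≢y
      ∑-identity f {y} {z ∷ ys} (_ ∷ u) (there y∈) | no z≢y =
        trans (cong₂ ℤ._+_ (ℤ.*-zeroʳ (f z)) (∑-identity f u y∈)) (ℤ.+-identityˡ (f y))

    weight : Matrix → X → List X → X → ℤ
    weight A x []      y = A x y
    weight A x (z ∷ w) y = A x z ℤ.* weight A z w y

    cyclicWeight : ∀ {n} → Matrix → Vec X (suc n) → ℤ
    cyclicWeight A (x ∷ w) = weight A x (toList w) x

    -- The power `suc n` has `n` free intermediate indices; in the base case the surplus factor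
    -- `identity` collapses its sum to the index `y`.
    ^ᴹ-expand : ∀ A n x y → (A ^ᴹ suc n) x y ≡ ∑ (vectors xs n) (λ w → weight A x (toList w) y)
    ^ᴹ-expand A zero    x y = trans (∑-identity (A x) unique (complete y)) (sym (ℤ.+-identityʳ (A x y)))
    ^ᴹ-expand A (suc n) x y = begin
      ∑ xs (λ z → A x z ℤ.* (A ^ᴹ suc n) z y)
        ≡⟨ ∑-cong xs (λ z → cong (A x z ℤ.*_) (^ᴹ-expand A n z y)) ⟩
      ∑ xs (λ z → A x z ℤ.* ∑ (vectors xs n) (λ w → weight A z (toList w) y))
        ≡⟨ ∑-cong xs (λ z → *-distribˡ-∑ (vectors xs n) (A x z) _) ⟩
      ∑ xs (λ z → ∑ (vectors xs n) (λ w → weight A x (z ∷ toList w) y))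
        ≡⟨ ∑-cartesianProductWith _∷_ xs (vectors xs n) _ ⟨
      ∑ (vectors xs (suc n)) (λ w → weight A x (toList w) y) ∎

    tr-^ᴹ : ∀ A n → tr (A ^ᴹ suc n) ≡ ∑ (vectors xs (suc n)) (cyclicWeight A)
    tr-^ᴹ A n = trans (∑-cong xs (λ x → ^ᴹ-expand A n x x))
                      (sym (∑-cartesianProductWith _∷_ xs (vectors xs n) (cyclicWeight A)))

  -- Averages of monomials in independent signs

  signs : List Sign
  signs = Sign.+ ∷ Sign.- ∷ []

  monomial : ∀ {n} → (Fin n → ℕ) → Vec Sign n → ℤ
  monomial c []      = 1ℤ
  monomial c (s ∷ σ) = (s ◃ 1) ℤ.^ c Fin.zero ℤ.* monomial (c ∘ Fin.suc) σ

  monomial-cong : ∀ {n} {c c′ : Fin n → ℕ} → (∀ i → c i ≡ c′ i) → ∀ σ → monomial c σ ≡ monomial c′ σ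
  monomial-cong c≗c′ []      = refl
  monomial-cong c≗c′ (s ∷ σ) =
    cong₂ (λ k m → (s ◃ 1) ℤ.^ k ℤ.* m) (c≗c′ Fin.zero) (monomial-cong (c≗c′ ∘ Fin.suc) σ)

  monomial-0 : ∀ {n} (σ : Vec Sign n) → monomial (λ _ → 0) σ ≡ 1ℤ
  monomial-0 []      = refl
  monomial-0 (s ∷ σ) = trans (ℤ.*-identityˡ _) (monomial-0 σ)

  -- The exponent is written in the form in which `count` unfolds on a cons, so that `head-count`
  -- below holds by `refl`.
  monomial-suc : ∀ {n} (c : Fin n → ℕ) j σ →
    monomial (λ i → (if does (j Fin.≟ i) then suc else id) (c i)) σ ≡ (lookup σ j ◃ 1) ℤ.* monomial c σ
  monomial-suc c Fin.zero    (s ∷ σ) = ℤ.*-assoc (s ◃ 1) _ _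
  monomial-suc c (Fin.suc j) (s ∷ σ) = begin
    p ℤ.* monomial _ σ                             ≡⟨ cong (p ℤ.*_) (monomial-suc (c ∘ Fin.suc) j σ) ⟩
    p ℤ.* ((lookup σ j ◃ 1) ℤ.* monomial _ σ)      ≡⟨ ℤ.*-assoc p (lookup σ j ◃ 1) _ ⟨
    p ℤ.* (lookup σ j ◃ 1) ℤ.* monomial _ σ        ≡⟨ cong (ℤ._* monomial _ σ) (ℤ.*-comm p (lookup σ j ◃ 1)) ⟩
    (lookup σ j ◃ 1) ℤ.* p ℤ.* monomial _ σ        ≡⟨ ℤ.*-assoc (lookup σ j ◃ 1) p _ ⟩
    (lookup σ j ◃ 1) ℤ.* (p ℤ.* monomial _ σ)      ∎
    where
    open ≡-Reasoning
    p = (s ◃ 1) ℤ.^ c Fin.zero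

  -1^even : ∀ k → 2 ∣ k → -1ℤ ℤ.^ k ≡ 1ℤ
  -1^even k (divides q refl) = begin
    -1ℤ ℤ.^ (q ℕ.* 2)   ≡⟨ cong (-1ℤ ℤ.^_) (ℕ.*-comm q 2) ⟩
    -1ℤ ℤ.^ (2 ℕ.* q)   ≡⟨ ℤ.^-*-assoc -1ℤ 2 q ⟨
    1ℤ ℤ.^ q            ≡⟨ ℤ.^-zeroˡ q ⟩
    1ℤ                  ∎
    where open ≡-Reasoning

  -1^odd : ∀ k → ¬ 2 ∣ k → -1ℤ ℤ.^ k ≡ -1ℤ
  -1^odd zero          2∤k = contradiction (2 ∣0) 2∤k
  -1^odd (suc zero)    2∤k = refl
  -1^odd (suc (suc k)) 2∤k = trans (sym (ℤ.*-assoc -1ℤ -1ℤ (-1ℤ ℤ.^ k)))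
    (trans (ℤ.*-identityˡ _) (-1^odd k (2∤k ∘ ∣m∣n⇒∣m+n ∣-refl)))

  module _ where
    open ≡-Reasoning

    -- The sum over all sign vectors factors over the coordinates. A factor 1 + (-1)^c is 2 for even
    -- and 0 for odd c, which settles the next two lemmas.
    ∑-monomial-suc : ∀ {n} (c : Fin (suc n) → ℕ) → ∑ (vectors signs (suc n)) (monomial c) ≡
      (1ℤ ℤ.+ -1ℤ ℤ.^ c Fin.zero) ℤ.* ∑ (vectors signs n) (monomial (c ∘ Fin.suc))
    ∑-monomial-suc {n} c = begin
      ∑ (vectors signs (suc n)) (monomial c)
        ≡⟨ ∑-cartesianProductWith _∷_ signs (vectors signs n) (monomial c) ⟩
      ∑ signs (λ s → ∑ (vectors signs n) (λ σ → (s ◃ 1) ℤ.^ k ℤ.* monomial (c ∘ Fin.suc) σ))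
        ≡⟨ ∑-cong signs (λ s → sym (*-distribˡ-∑ (vectors signs n) ((s ◃ 1) ℤ.^ k) (monomial (c ∘ Fin.suc)))) ⟩
      ∑ signs (λ s → (s ◃ 1) ℤ.^ k ℤ.* rest)
        ≡⟨ *-distribʳ-∑ signs rest (λ s → (s ◃ 1) ℤ.^ k) ⟨
      (1ℤ ℤ.^ k ℤ.+ (-1ℤ ℤ.^ k ℤ.+ 0ℤ)) ℤ.* rest
        ≡⟨ cong (ℤ._* rest) (cong₂ ℤ._+_ (ℤ.^-zeroˡ k) (ℤ.+-identityʳ (-1ℤ ℤ.^ k))) ⟩
      (1ℤ ℤ.+ -1ℤ ℤ.^ k) ℤ.* rest ∎
      where
      k = c Fin.zero
      rest = ∑ (vectors signs n) (monomial (c ∘ Fin.suc))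

    ∑-monomial-even : ∀ {n} (c : Fin n → ℕ) → (∀ i → 2 ∣ c i) →
                      ∑ (vectors signs n) (monomial c) ≡ + (2 ℕ.^ n)
    ∑-monomial-even {zero}  c even = refl
    ∑-monomial-even {suc n} c even = begin
      ∑ (vectors signs (suc n)) (monomial c)         ≡⟨ ∑-monomial-suc c ⟩
      (1ℤ ℤ.+ -1ℤ ℤ.^ c Fin.zero) ℤ.* ∑ (vectors signs n) (monomial (c ∘ Fin.suc))
        ≡⟨ cong₂ (λ x y → (1ℤ ℤ.+ x) ℤ.* y) (-1^even (c Fin.zero) (even Fin.zero))
                                             (∑-monomial-even (c ∘ Fin.suc) (even ∘ Fin.suc)) ⟩
      + 2 ℤ.* + (2 ℕ.^ n)                            ≡⟨ ℤ.pos-* 2 (2 ℕ.^ n) ⟨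
      + (2 ℕ.* 2 ℕ.^ n)                              ∎

    ∑-monomial-odd : ∀ {n} (c : Fin n → ℕ) i → ¬ 2 ∣ c i → ∑ (vectors signs n) (monomial c) ≡ 0ℤ
    ∑-monomial-odd c Fin.zero    odd = trans (∑-monomial-suc c)
      (cong (λ x → (1ℤ ℤ.+ x) ℤ.* ∑ (vectors signs _) (monomial (c ∘ Fin.suc))) (-1^odd (c Fin.zero) odd))
    ∑-monomial-odd c (Fin.suc i) odd = trans (∑-monomial-suc c)
      (trans (cong ((1ℤ ℤ.+ -1ℤ ℤ.^ c Fin.zero) ℤ.*_) (∑-monomial-odd (c ∘ Fin.suc) i odd))
             (ℤ.*-zeroʳ (1ℤ ℤ.+ -1ℤ ℤ.^ c Fin.zero)))

  -- Counting with lists without repetitions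

  ∈-vectors : {A : Set} {xs : List A} → (∀ x → x ∈ xs) → ∀ {n} (v : Vec A n) → v ∈ vectors xs n
  ∈-vectors complete []      = here refl
  ∈-vectors complete (x ∷ v) = ∈-cartesianProductWith⁺ _∷_ (complete x) (∈-vectors complete v)

  vectors-unique : {A : Set} {xs : List A} → Unique xs → ∀ n → Unique (vectors xs n)
  vectors-unique unique zero    = [] ∷ []
  vectors-unique unique (suc n) =
    Unique.cartesianProductWith⁺ _∷_ (λ { refl → refl , refl }) unique (vectors-unique unique n)

  length-cartesianProductWith : {A B C : Set} (h : A → B → C) (xs : List A) (ys : List B) →
    length (cartesianProductWith h xs ys) ≡ length xs ℕ.* length ys
  length-cartesianProductWith h []       ys = refl
  length-cartesianProductWith h (x ∷ xs) ys = trans (List.length-++ (map (h x) ys))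
    (cong₂ ℕ._+_ (List.length-map (h x) ys) (length-cartesianProductWith h xs ys))

  length-vectors : {A : Set} (xs : List A) → ∀ n → length (vectors xs n) ≡ length xs ℕ.^ n
  length-vectors xs zero    = refl
  length-vectors xs (suc n) = trans (length-cartesianProductWith Vec._∷_ xs (vectors xs n))
    (cong (length xs ℕ.*_) (length-vectors xs n))

  -- The head of `xs` is cut out of `ys`; the tail still fits, since the head does not recur in it.
  -- All lower bounds for `Ev` come from this lemma.
  unique⊆⇒length≤ : {A : Set} {xs ys : List A} → Unique xs → xs ⊆ ys → length xs ℕ.≤ length ys
  unique⊆⇒length≤ {xs = []}     _        _    = ℕ.z≤n
  unique⊆⇒length≤ {xs = x ∷ xs} (x∉ ∷ u) xs⊆ys with ∈-∃++ (xs⊆ys (here refl))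
  ... | ys₁ , ys₂ , refl = begin
    suc (length xs)                  ≤⟨ ℕ.s≤s (unique⊆⇒length≤ u xs⊆rest) ⟩
    suc (length (ys₁ List.++ ys₂))   ≡⟨ cong suc (List.length-++ ys₁) ⟩
    suc (length ys₁ ℕ.+ length ys₂)  ≡⟨ ℕ.+-suc (length ys₁) (length ys₂) ⟨
    length ys₁ ℕ.+ suc (length ys₂)  ≡⟨ List.length-++ ys₁ ⟨
    length (ys₁ List.++ x ∷ ys₂)     ∎
    where
    open ℕ.≤-Reasoning
    xs⊆rest : xs ⊆ ys₁ List.++ ys₂
    xs⊆rest {z} z∈ with ∈-++⁻ ys₁ (xs⊆ys (there z∈))
    ... | inj₁ z∈ys₁         = ∈-++⁺ˡ z∈ys₁
    ... | inj₂ (here refl)   = contradiction z∈ (All¬⇒¬Any x∉)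
    ... | inj₂ (there z∈ys₂) = ∈-++⁺ʳ ys₁ z∈ys₂

  count-toList : {A : Set} {P : A → Set} (P? : ∀ x → Dec (P x)) → ∀ {n} (w : Vec A n) →
                 count P? w ≡ length (filter P? (toList w))
  count-toList P? []      = refl
  count-toList P? (x ∷ w) with does (P? x)
  ... | true  = cong suc (count-toList P? w)
  ... | false = count-toList P? w

  count-++ : {A : Set} {P : A → Set} (P? : ∀ x → Dec (P x)) → ∀ {m n} (v : Vec A m) (w : Vec A n) →
             count P? (v Vec.++ w) ≡ count P? v ℕ.+ count P? w
  count-++ P? []      w = refl
  count-++ P? (x ∷ v) w with does (P? x)
  ... | true  = cong suc (count-++ P? v w)
  ... | false = count-++ P? v w

  2∣n+n : ∀ n → 2 ∣ n ℕ.+ n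
  2∣n+n n = subst (2 ∣_) (cong (n ℕ.+_) (ℕ.+-identityʳ n)) (m∣m*n n)

  [i*n]/n≡i/1 : ∀ i n .{{_ : ℕ.NonZero n}} → (i ℤ.* + n) ℚ./ n ≡ i ℚ./ 1
  [i*n]/n≡i/1 i (suc n) = ℚ.fromℚᵘ-cong {mkℚᵘ (i ℤ.* + suc n) n} {mkℚᵘ i 0} (*≡* (ℤ.*-identityʳ _))

  -- The trace formula and the doubling map

  module ClosedWalks (G : Graph) where
    open Graph G
    open NonBacktracking G
    open Walk _⇝_

    directedEdges-complete : ∀ e → e ∈ directedEdges
    directedEdges-complete (i , false) = ∈-cartesianProduct⁺ (∈-allFin i) (here refl)
    directedEdges-complete (i , true)  = ∈-cartesianProduct⁺ (∈-allFin i) (there (here refl))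

    directedEdges-unique : Unique directedEdges
    directedEdges-unique = Unique.cartesianProduct⁺ (Unique.allFin⁺ ∣E∣) (((λ ()) ∷ []) ∷ [] ∷ [])

    open MatrixPowers directedEdges _≟ᴰ_ directedEdges-unique directedEdges-complete public

    linked? : ∀ x w y → Dec (Linked x w y)
    linked? x []      y = x ⇝? y
    linked? x (z ∷ w) y = (x ⇝? z) ×-dec linked? z w y

    closed⇔linked : ∀ {n} x (w : Vec DirectedEdge n) → IsClosedNB (x ∷ w) ⇔ Linked x (toList w) x
    closed⇔linked x w = cyclic⇔linked x w

    signOf : Signing → DirectedEdge → ℤ
    signOf σ e = lookup σ (edge e) ◃ 1

    signProduct : ∀ {n} → Signing → Vec DirectedEdge n → ℤ
    signProduct σ []      = 1ℤ
    signProduct σ (e ∷ w) = signOf σ e ℤ.* signProduct σ w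

    -- An entry of `Bσ` carries the sign of its second edge, so the sign of `y` enters and that of
    -- `x` does not. When the walk closes up, `y` is `x` and each position counts once.
    weight-Bσ : ∀ σ {n} x (w : Vec DirectedEdge n) y →
      weight (Bσ σ) x (toList w) y ≡
      (if does (linked? x (toList w) y) then signOf σ y ℤ.* signProduct σ w else 0ℤ)
    weight-Bσ σ x []      y = cong (λ a → if does (x ⇝? y) then a else 0ℤ)
                                   (sym (ℤ.*-identityʳ (signOf σ y)))
    weight-Bσ σ x (z ∷ w) y rewrite weight-Bσ σ z w y
      with does (x ⇝? z) | does (linked? z (toList w) y)
    ... | false | _     = refl
    ... | true  | false = ℤ.*-zeroʳ (signOf σ z)
    ... | true  | true  = begin
      sz ℤ.* (sy ℤ.* signProduct σ w)   ≡⟨ ℤ.*-assoc sz sy _ ⟨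
      sz ℤ.* sy ℤ.* signProduct σ w     ≡⟨ cong (ℤ._* signProduct σ w) (ℤ.*-comm sz sy) ⟩
      sy ℤ.* sz ℤ.* signProduct σ w     ≡⟨ ℤ.*-assoc sy sz _ ⟩
      sy ℤ.* (sz ℤ.* signProduct σ w)   ∎
      where
      open ≡-Reasoning
      sz = signOf σ z
      sy = signOf σ y

    cyclicWeight-Bσ : ∀ σ {n} (w : Vec DirectedEdge (suc n)) →
      cyclicWeight (Bσ σ) w ≡ (if does (isClosedNB? w) then signProduct σ w else 0ℤ)
    cyclicWeight-Bσ σ (x ∷ w) = trans (weight-Bσ σ x w x)
      (cong (λ b → if b then signProduct σ (x ∷ w) else 0ℤ)
            (sym (does-⇔ (closed⇔linked x w) (isClosedNB? (x ∷ w)) (linked? x (toList w) x))))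

    tr-Bσ : ∀ σ n → tr (Bσ σ ^ᴹ suc n) ≡
      ∑ (vectors directedEdges (suc n)) (λ w → if does (isClosedNB? w) then signProduct σ w else 0ℤ)
    tr-Bσ σ n = trans (tr-^ᴹ (Bσ σ) n) (∑-cong (vectors directedEdges (suc n)) (cyclicWeight-Bσ σ))

    occurrences : ∀ {n} → Vec DirectedEdge n → Fin ∣E∣ → ℕ
    occurrences w i = count (λ e → edge e Fin.≟ i) w

    signProduct≡monomial : ∀ σ {n} (w : Vec DirectedEdge n) → signProduct σ w ≡ monomial (occurrences w) σ
    signProduct≡monomial σ []      = sym (monomial-0 σ)
    signProduct≡monomial σ (e ∷ w) = trans (cong (signOf σ e ℤ.*_) (signProduct≡monomial σ w))
      (sym (trans (monomial-cong head-count σ) (monomial-suc (occurrences w) (edge e) σ)))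
      where
      head-count : ∀ i → occurrences (e ∷ w) i ≡ (if does (edge e Fin.≟ i) then suc else id) (occurrences w i)
      head-count i = refl

    ∑-signProduct : ∀ {n} (w : Vec DirectedEdge n) → ∑ (vectors signs ∣E∣) (λ σ → signProduct σ w) ≡
                    (if does (isTotallyEven? w) then + (2 ℕ.^ ∣E∣) else 0ℤ)
    ∑-signProduct w = trans (∑-cong (vectors signs ∣E∣) (λ σ → signProduct≡monomial σ w))
                            (split (isTotallyEven? w))
      where
      split : (even? : Dec (IsTotallyEven w)) → ∑ (vectors signs ∣E∣) (monomial (occurrences w)) ≡
              (if does even? then + (2 ℕ.^ ∣E∣) else 0ℤ)
      split (yes even) = ∑-monomial-even (occurrences w) even
      split (no ¬even) with i , odd ← Fin.¬∀⟶∃¬ ∣E∣ _ (λ i → 2 ∣? occurrences w i) ¬even =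
        ∑-monomial-odd (occurrences w) i odd

    ∑-if : {A : Set} (xs : List A) (b : Bool) (f : A → ℤ) →
           ∑ xs (λ x → if b then f x else 0ℤ) ≡ (if b then ∑ xs f else 0ℤ)
    ∑-if xs true  f = refl
    ∑-if xs false f = ∑-zero xs

    if-∧ : ∀ a {b} {x : ℤ} → (if a then if b then x else 0ℤ else 0ℤ) ≡ (if a ∧ b then x else 0ℤ)
    if-∧ true  = refl
    if-∧ false = refl

    ∑-tr-Bσ : ∀ n → ∑ (vectors signs ∣E∣) (λ σ → tr (Bσ σ ^ᴹ suc n)) ≡ + Ev (suc n) ℤ.* + (2 ℕ.^ ∣E∣)
    ∑-tr-Bσ n = begin
      ∑ Σ (λ σ → tr (Bσ σ ^ᴹ suc n))
        ≡⟨ ∑-cong Σ (λ σ → tr-Bσ σ n) ⟩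
      ∑ Σ (λ σ → ∑ W (λ w → if closed w then signProduct σ w else 0ℤ))
        ≡⟨ ∑-swap Σ W _ ⟩
      ∑ W (λ w → ∑ Σ (λ σ → if closed w then signProduct σ w else 0ℤ))
        ≡⟨ ∑-cong W (λ w → ∑-if Σ (closed w) (λ σ → signProduct σ w)) ⟩
      ∑ W (λ w → if closed w then ∑ Σ (λ σ → signProduct σ w) else 0ℤ)
        ≡⟨ ∑-cong W (λ w → cong (λ x → if closed w then x else 0ℤ) (∑-signProduct w)) ⟩
      ∑ W (λ w → if closed w then (if does (isTotallyEven? w) then + (2 ℕ.^ ∣E∣) else 0ℤ) else 0ℤ)
        ≡⟨ ∑-cong W (λ w → if-∧ (closed w)) ⟩
      ∑ W (λ w → if does (isClosedNB? w ×-dec isTotallyEven? w) then + (2 ℕ.^ ∣E∣) else 0ℤ)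
        ≡⟨ ∑-filter (λ w → isClosedNB? w ×-dec isTotallyEven? w) W (+ (2 ℕ.^ ∣E∣)) ⟩
      + Ev (suc n) ℤ.* + (2 ℕ.^ ∣E∣) ∎
      where
      open ≡-Reasoning
      Σ = vectors signs ∣E∣
      W = vectors directedEdges (suc n)
      closed : Vec DirectedEdge (suc n) → Bool
      closed w = does (isClosedNB? w)

    Ev≡𝔼σ-tr : ∀ ℓ → 1 ℕ.≤ ℓ → + Ev ℓ ℚ./ 1 ≡ 𝔼σ (λ σ → tr (Bσ σ ^ᴹ ℓ))
    Ev≡𝔼σ-tr (suc n) _ = sym (trans
      (cong (λ i → ℚ._/_ i (2 ℕ.^ ∣E∣) {{2^∣E∣≢0}}) (∑-tr-Bσ n))
      ([i*n]/n≡i/1 (+ Ev (suc n)) (2 ℕ.^ ∣E∣) {{2^∣E∣≢0}}))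
      where
      2^∣E∣≢0 = ℕ.m^n≢0 2 ∣E∣

    doubling-closed : ∀ {k} (w : Vec DirectedEdge k) → 1 ℕ.≤ k → IsClosedNB w → IsClosedNB (w Vec.++ w)
    doubling-closed (x ∷ w) _ c = Equivalence.from (closed⇔linked x (w Vec.++ x ∷ w))
      (subst (λ v → Linked x v x) (sym (Vec.toList-++ w (x ∷ w))) (linked-++⁺ (toList w) (toList w) l l))
      where l = Equivalence.to (closed⇔linked x w) c

    doubling-even : ∀ {k} (w : Vec DirectedEdge k) → IsTotallyEven (w Vec.++ w)
    doubling-even w i = subst (2 ∣_) (sym (count-++ (λ e → edge e Fin.≟ i) w w)) (2∣n+n (occurrences w i))

    signProduct-+ : ∀ {n} (w : Vec DirectedEdge n) → signProduct (Vec.replicate ∣E∣ Sign.+) w ≡ 1ℤ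
    signProduct-+ []      = refl
    signProduct-+ (e ∷ w) rewrite Vec.lookup-replicate (edge e) Sign.+ = trans (ℤ.*-identityˡ _) (signProduct-+ w)

    tr-B : ∀ n → tr (B ^ᴹ suc n) ≡ + length (filter isClosedNB? (vectors directedEdges (suc n)))
    tr-B n = begin
      tr (B ^ᴹ suc n)  ≡⟨ tr-Bσ _ n ⟩
      ∑ W (λ w → if does (isClosedNB? w) then signProduct _ w else 0ℤ)
        ≡⟨ ∑-cong W (λ w → cong (λ x → if does (isClosedNB? w) then x else 0ℤ) (signProduct-+ w)) ⟩
      ∑ W (λ w → if does (isClosedNB? w) then 1ℤ else 0ℤ)  ≡⟨ ∑-filter isClosedNB? W 1ℤ ⟩
      + length (filter isClosedNB? W) ℤ.* 1ℤ               ≡⟨ ℤ.*-identityʳ _ ⟩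
      + length (filter isClosedNB? W)                      ∎
      where
      open ≡-Reasoning
      W = vectors directedEdges (suc n)

    EvenWalk : ∀ {ℓ} → Vec DirectedEdge ℓ → Set
    EvenWalk w = IsClosedNB w × IsTotallyEven w

    unique⇒length≤Ev : ∀ {ℓ} {ws : List (Vec DirectedEdge ℓ)} → Unique ws →
                       (∀ {w} → w ∈ ws → EvenWalk w) → length ws ℕ.≤ Ev ℓ
    unique⇒length≤Ev unique even = unique⊆⇒length≤ unique λ {w} w∈ws →
      ∈-filter⁺ (λ w → isClosedNB? w ×-dec isTotallyEven? w) (∈-vectors directedEdges-complete w) (even w∈ws)

    tr-B≤Ev : ∀ k → 1 ℕ.≤ k → tr (B ^ᴹ k) ℤ.≤ + Ev (k ℕ.+ k)
    tr-B≤Ev (suc n) 1≤k = subst (ℤ._≤ + Ev (k ℕ.+ k)) (sym (tr-B n)) (ℤ.+≤+ (begin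
      length closed                ≡⟨ List.length-map double closed ⟨
      length (map double closed)   ≤⟨ unique⇒length≤Ev (Unique.map⁺ (λ {v} {w} → Vec.++-injectiveˡ v w)
                                        (Unique.filter⁺ isClosedNB? (vectors-unique directedEdges-unique k)))
                                        even ⟩
      Ev (k ℕ.+ k) ∎))
      where
      open ℕ.≤-Reasoning
      k = suc n
      double : Vec DirectedEdge k → Vec DirectedEdge (k ℕ.+ k)
      double w = w Vec.++ w
      closed = filter isClosedNB? (vectors directedEdges k)
      even : ∀ {w} → w ∈ map double closed → EvenWalk w
      even w∈ with v , v∈ , refl ← ∈-map⁻ double w∈ =
        doubling-closed v 1≤k (proj₂ (∈-filter⁻ isClosedNB? {xs = vectors directedEdges k} v∈)) , doubling-even v

  length-filter-split : {A : Set} {P Q : A → Set} (P? : ∀ x → Dec (P x)) (Q? : ∀ x → Dec (Q x)) →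
    (∀ {x} → Q x → P x) → ∀ xs →
    length (filter P? xs) ≡ length (filter (λ x → P? x ×-dec ¬? (Q? x)) xs) ℕ.+ length (filter Q? xs)
  length-filter-split P? Q? Q⇒P []       = refl
  length-filter-split P? Q? Q⇒P (x ∷ xs) with P? x | Q? x
  ... | yes _ | yes _ = trans (cong suc (length-filter-split P? Q? Q⇒P xs)) (sym (ℕ.+-suc _ _))
  ... | yes _ | no _  = cong suc (length-filter-split P? Q? Q⇒P xs)
  ... | no ¬p | yes q = contradiction (Q⇒P q) ¬p
  ... | no _  | no _  = length-filter-split P? Q? Q⇒P xs

  length-filter-≡ : {A : Set} (_≟_ : DecidableEquality A) {xs : List A} {y : A} →
                    Unique xs → y ∈ xs → length (filter (_≟ y) xs) ≡ 1
  length-filter-≡ _≟_ {xs} {y} unique y∈xs = ℕ.≤-antisym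
    (unique⊆⇒length≤ {ys = y ∷ []} (Unique.filter⁺ (_≟ y) unique) (λ z∈ → here (proj₂ (∈-filter⁻ (_≟ y) {xs = xs} z∈))))
    (unique⊆⇒length≤ {xs = y ∷ []} ([] ∷ []) λ { (here refl) → ∈-filter⁺ (_≟ y) y∈xs refl })

  ∑-mono-≤ : {A : Set} (xs : List A) {f g : A → ℤ} → (∀ x → f x ℤ.≤ g x) → ∑ xs f ℤ.≤ ∑ xs g
  ∑-mono-≤ []       f≤g = ℤ.≤-refl
  ∑-mono-≤ (x ∷ xs) f≤g = ℤ.+-mono-≤ (f≤g x) (∑-mono-≤ xs f≤g)

  -- A strict inequality in one term would make the sums differ. This turns a global balance of
  -- flows into an equality on each single step.
  ≤∧∑≡⇒≡ : {A : Set} (xs : List A) {f g : A → ℤ} → (∀ x → f x ℤ.≤ g x) →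
               ∑ xs f ≡ ∑ xs g → ∀ {x} → x ∈ xs → f x ≡ g x
  ≤∧∑≡⇒≡ (z ∷ xs) {f} {g} f≤g eq = λ
    { (here refl) → ℤ.≤-antisym (f≤g z)
        (ℤ.≮⇒≥ λ f<g → ℤ.<-irrefl eq (ℤ.+-mono-<-≤ f<g (∑-mono-≤ xs f≤g)))
    ; (there x∈)  → ≤∧∑≡⇒≡ xs f≤g (ℤ.≤-antisym (∑-mono-≤ xs f≤g)
        (ℤ.≮⇒≥ λ ∑f<∑g → ℤ.<-irrefl eq (ℤ.+-mono-≤-< (f≤g z) ∑f<∑g))) x∈ }

  -- Row and column sums of `B`

  module RegularGraph (G : Graph) (d : ℕ) (regular : NonBacktracking.Regular G d) where
    open Graph G
    open NonBacktracking G
    open ClosedWalks G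

    successors : DirectedEdge → List DirectedEdge
    successors e = filter (e ⇝?_) directedEdges

    -- Of the `d` edges that leave the head of `e`, exactly one is `rev e`.
    length-successors : ∀ e → length (successors e) ≡ d ℕ.∸ 1
    length-successors e = sym (begin
      d ℕ.∸ 1
        ≡⟨ cong (ℕ._∸ 1) (regular (head e)) ⟨
      length (filter (λ f → tail f Fin.≟ head e) directedEdges) ℕ.∸ 1
        ≡⟨ cong (λ xs → length xs ℕ.∸ 1) (List.filter-≐ (λ f → tail f Fin.≟ head e)
             (λ f → head e Fin.≟ tail f) (sym , sym) directedEdges) ⟩
      length (filter (λ f → head e Fin.≟ tail f) directedEdges) ℕ.∸ 1
        ≡⟨ cong (ℕ._∸ 1) (length-filter-split (λ f → head e Fin.≟ tail f) (_≟ᴰ rev e)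
             (λ { refl → refl }) directedEdges) ⟩
      length (successors e) ℕ.+ length (filter (_≟ᴰ rev e) directedEdges) ℕ.∸ 1
        ≡⟨ cong (λ n → length (successors e) ℕ.+ n ℕ.∸ 1)
             (length-filter-≡ _≟ᴰ_ directedEdges-unique (directedEdges-complete (rev e))) ⟩
      length (successors e) ℕ.+ 1 ℕ.∸ 1
        ≡⟨ ℕ.m+n∸n≡m (length (successors e)) 1 ⟩
      length (successors e) ∎)
      where open ≡-Reasoning

    adjacency : Matrix
    adjacency e f = if does (e ⇝? f) then 1ℤ else 0ℤ

    B≡adjacency : ∀ e f → B e f ≡ adjacency e f
    B≡adjacency e f = cong (λ s → if does (e ⇝? f) then s ◃ 1 else 0ℤ) (Vec.lookup-replicate (edge f) Sign.+)

    0≤B : ∀ e f → 0ℤ ℤ.≤ B e f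
    0≤B e f = subst (0ℤ ℤ.≤_) (sym (B≡adjacency e f)) (0≤if (does (e ⇝? f)))
      where
      0≤if : ∀ b → 0ℤ ℤ.≤ (if b then 1ℤ else 0ℤ)
      0≤if true  = ℤ.+≤+ ℕ.z≤n
      0≤if false = ℤ.≤-refl

    row-sum : ∀ e → ∑ directedEdges (B e) ≡ + (d ℕ.∸ 1)
    row-sum e = begin
      ∑ directedEdges (B e)            ≡⟨ ∑-cong directedEdges (B≡adjacency e) ⟩
      ∑ directedEdges (adjacency e)    ≡⟨ ∑-filter (e ⇝?_) directedEdges 1ℤ ⟩
      + length (successors e) ℤ.* 1ℤ   ≡⟨ ℤ.*-identityʳ _ ⟩
      + length (successors e)          ≡⟨ cong +_ (length-successors e) ⟩
      + (d ℕ.∸ 1)                      ∎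
      where open ≡-Reasoning

    rev-involutive : ∀ e → rev (rev e) ≡ e
    rev-involutive (i , b) = cong (i ,_) (Bool.not-involutive b)

    head-rev : ∀ e → head (rev e) ≡ tail e
    head-rev e = cong tail (rev-involutive e)

    rev-⇝ : ∀ {e f} → e ⇝ f → rev f ⇝ rev e
    rev-⇝ {e} {f} (h≡t , f≢) = trans (head-rev f) (sym h≡t) ,
      λ re≡rrf → f≢ (trans (sym (rev-involutive f)) (sym re≡rrf))

    ∑-rev : ∀ (g : DirectedEdge → ℤ) → ∑ directedEdges (g ∘ rev) ≡ ∑ directedEdges g
    ∑-rev g = begin
      ∑ directedEdges (g ∘ rev)
        ≡⟨ ∑-cartesianProductWith _,_ (allFin ∣E∣) orientations (g ∘ rev) ⟩
      ∑ (allFin ∣E∣) (λ i → g (i , true) ℤ.+ (g (i , false) ℤ.+ 0ℤ))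
        ≡⟨ ∑-cong (allFin ∣E∣) (λ i → swap (g (i , true)) (g (i , false))) ⟩
      ∑ (allFin ∣E∣) (λ i → g (i , false) ℤ.+ (g (i , true) ℤ.+ 0ℤ))
        ≡⟨ ∑-cartesianProductWith _,_ (allFin ∣E∣) orientations g ⟨
      ∑ directedEdges g ∎
      where
      open ≡-Reasoning
      orientations = false ∷ true ∷ []
      swap : ∀ a b → a ℤ.+ (b ℤ.+ 0ℤ) ≡ b ℤ.+ (a ℤ.+ 0ℤ)
      swap a b rewrite ℤ.+-identityʳ a | ℤ.+-identityʳ b = ℤ.+-comm a b

    -- Reversing both edges transposes `B`, because a walk read backwards is again non-backtracking.
    -- So the column of `f` is the row of `rev f`, permuted by `rev`.
    column-sum : ∀ f → ∑ directedEdges (λ e → B e f) ≡ + (d ℕ.∸ 1)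
    column-sum f = begin
      ∑ directedEdges (λ e → B e f)                ≡⟨ ∑-cong directedEdges reverse ⟩
      ∑ directedEdges (λ e → B (rev f) (rev e))    ≡⟨ ∑-rev (B (rev f)) ⟩
      ∑ directedEdges (B (rev f))                  ≡⟨ row-sum (rev f) ⟩
      + (d ℕ.∸ 1)                                  ∎
      where
      open ≡-Reasoning
      reverse : ∀ e → B e f ≡ B (rev f) (rev e)
      reverse e = trans (B≡adjacency e f) (trans
        (cong (λ b → if b then 1ℤ else 0ℤ) (does-⇔ (mk⇔ (rev-⇝ {e} {f}) unrev) (e ⇝? f) (rev f ⇝? rev e)))
        (sym (B≡adjacency (rev f) (rev e))))
        where
        unrev : rev f ⇝ rev e → e ⇝ f
        unrev r = subst₂ _⇝_ (rev-involutive e) (rev-involutive f) (rev-⇝ {rev f} {rev e} r)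

    -- The list contains the edges after `e` up to and including `f`, whereas in `Linked` it
    -- excludes both ends.
    Path : DirectedEdge → List DirectedEdge → DirectedEdge → Set
    Path e []       f = e ≡ f
    Path e (z ∷ zs) f = e ⇝ z × Path z zs f

    path-++ : ∀ {e f g} xs {ys} → Path e xs f → Path f ys g → Path e (xs List.++ ys) g
    path-++ []       refl    q = q
    path-++ (_ ∷ xs) (l , p) q = l , path-++ xs p q

    Reachable : DirectedEdge → DirectedEdge → Set
    Reachable e f = ∃[ xs ] Path e xs f

    reachable-trans : ∀ {e f g} → Reachable e f → Reachable f g → Reachable e g
    reachable-trans (xs , p) (ys , q) = xs List.++ ys , path-++ xs p q

    ⇝⇒reachable : ∀ {e f} → e ⇝ f → Reachable e f
    ⇝⇒reachable {f = f} l = f ∷ [] , l , refl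

    -- Strong connectivity of the step relation

    open DecMembership _≟ᴰ_ using (_∈?_)

    -- The closed set is the complement of `us`; the list holds the edges that a search has not
    -- reached yet.
    SuccessorClosed : List DirectedEdge → Set
    SuccessorClosed us = ∀ {x y} → x ∉ us → x ⇝ y → y ∉ us

    module _ (f : DirectedEdge) where

      -- Each round of the search removes from `us` an edge that has a predecessor outside `us` and
      -- hence is reachable; `n` bounds the number of rounds. The inclusion `vs ⊆ us` later
      -- guarantees that `f` stays outside `vs`.
      saturate : ∀ n us → length us ℕ.≤ n → (∀ x → x ∈ us ⊎ Reachable f x) →
        ∃[ vs ] vs ⊆ us × (∀ x → x ∈ vs ⊎ Reachable f x) × SuccessorClosed vs
      saturate zero    []       _     cover = [] , id , cover , λ _ _ ()
      saturate (suc n) us ∣us∣≤n cover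
        with any? (λ y → any? (λ x → ¬? (x ∈? us) ×-dec (x ⇝? y)) directedEdges) us
      ... | no closed = us , id , cover , λ {x} x∉ x⇝y y∈ →
            closed (lose y∈ (lose (directedEdges-complete x) (x∉ , x⇝y)))
      ... | yes open′ with find open′
      ...   | y , y∈us , any-x with find any-x
      ...     | x , _ , x∉us , x⇝y =
        let vs , vs⊆ , cover′ , closed = saturate n us′ ∣us′∣≤n cover″
        in vs , (λ z∈ → proj₁ (∈-filter⁻ y≢? {xs = us} (vs⊆ z∈))) , cover′ , closed
        where
        y≢? = λ z → ¬? (z ≟ᴰ y)
        us′ = filter y≢? us
        ∣us′∣≤n : length us′ ℕ.≤ n
        ∣us′∣≤n = ℕ.s≤s⁻¹ (ℕ.≤-trans
          (List.filter-notAll y≢? us (lose y∈us (λ y≢y → y≢y refl))) ∣us∣≤n)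
        reach-y : Reachable f y
        reach-y with cover x
        ... | inj₁ x∈us = contradiction x∈us x∉us
        ... | inj₂ f→x  = reachable-trans f→x (⇝⇒reachable x⇝y)
        cover″ : ∀ z → z ∈ us′ ⊎ Reachable f z
        cover″ z with z ≟ᴰ y | cover z
        ... | yes refl | _         = inj₂ reach-y
        ... | no z≢y   | inj₁ z∈us = inj₁ (∈-filter⁺ y≢? z∈us z≢y)
        ... | no _     | inj₂ f→z  = inj₂ f→z

    module _ {us : List DirectedEdge} (closed : SuccessorClosed us) where

      private
        indicator : DirectedEdge → ℤ
        indicator x = if does (x ∈? us) then 0ℤ else 1ℤ

        outgoing : ∑ directedEdges (λ x → ∑ directedEdges (λ y → B x y ℤ.* indicator x)) ≡
                   + (d ℕ.∸ 1) ℤ.* ∑ directedEdges indicator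
        outgoing = trans (∑-cong directedEdges λ x →
            trans (sym (*-distribʳ-∑ directedEdges (indicator x) (B x))) (cong (ℤ._* indicator x) (row-sum x)))
          (sym (*-distribˡ-∑ directedEdges (+ (d ℕ.∸ 1)) indicator))

        incoming : ∑ directedEdges (λ x → ∑ directedEdges (λ y → B x y ℤ.* indicator y)) ≡
                   + (d ℕ.∸ 1) ℤ.* ∑ directedEdges indicator
        incoming = trans (∑-swap directedEdges directedEdges _) (trans (∑-cong directedEdges λ y →
            trans (sym (*-distribʳ-∑ directedEdges (indicator y) (λ x → B x y)))
                  (cong (ℤ._* indicator y) (column-sum y)))
          (sym (*-distribˡ-∑ directedEdges (+ (d ℕ.∸ 1)) indicator)))

        flow-≤ : ∀ x y → B x y ℤ.* indicator x ℤ.≤ B x y ℤ.* indicator y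
        flow-≤ x y = subst (λ b → b ℤ.* indicator x ℤ.≤ b ℤ.* indicator y) (sym (B≡adjacency x y))
                           (cases (x ⇝? y) (x ∈? us) (y ∈? us))
          where
          cases : (x⇝?y : Dec (x ⇝ y)) (x∈?us : Dec (x ∈ us)) (y∈?us : Dec (y ∈ us)) →
            (if does x⇝?y then 1ℤ else 0ℤ) ℤ.* (if does x∈?us then 0ℤ else 1ℤ) ℤ.≤
            (if does x⇝?y then 1ℤ else 0ℤ) ℤ.* (if does y∈?us then 0ℤ else 1ℤ)
          cases (no _)    _         _          = ℤ.≤-refl
          cases (yes _)   (yes _)   (yes _)    = ℤ.≤-refl
          cases (yes _)   (yes _)   (no _)     = ℤ.+≤+ ℕ.z≤n
          cases (yes x⇝y) (no x∉us) (yes y∈us) = contradiction y∈us (closed x∉us x⇝y)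
          cases (yes _)   (no _)    (no _)     = ℤ.≤-refl

        flow-≡ : ∀ x y → B x y ℤ.* indicator x ≡ B x y ℤ.* indicator y
        -- Equality of the two double sums is pushed down first to the row of `x`, then to the
        -- single entry.
        flow-≡ x y = ≤∧∑≡⇒≡ directedEdges (flow-≤ x)
          (≤∧∑≡⇒≡ directedEdges (λ x → ∑-mono-≤ directedEdges (flow-≤ x))
            (trans outgoing (sym incoming)) (directedEdges-complete x))
          (directedEdges-complete y)

      -- Row and column sums of B agree, so as many steps enter the complement of `us`
      -- as leave it; closure under successors means that none leaves.
      predecessorClosed : ∀ {x y} → y ∉ us → x ⇝ y → x ∉ us
      predecessorClosed {x} {y} y∉ x⇝y x∈ = 0≢1 (subst₂ _≡_
        (cong₂ ℤ._*_ one (cong (λ b → if b then 0ℤ else 1ℤ) (dec-true (x ∈? us) x∈)))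
        (cong₂ ℤ._*_ one (cong (λ b → if b then 0ℤ else 1ℤ) (dec-false (y ∈? us) y∉)))
        (flow-≡ x y))
        where
        0≢1 : ¬ 1ℤ ℤ.* 0ℤ ≡ 1ℤ ℤ.* 1ℤ
        0≢1 ()
        one : B x y ≡ 1ℤ
        one = trans (B≡adjacency x y) (cong (λ b → if b then 1ℤ else 0ℤ) (dec-true (x ⇝? y) x⇝y))

    -- The edges outside `vs` form a successor-closed set that contains `f`. By the balance of flows
    -- it is closed under predecessors too, so it contains `e`.
    ⇝⇒reachable-back : ∀ {e f} → e ⇝ f → Reachable f e
    ⇝⇒reachable-back {e} {f} e⇝f with saturate f _ us ℕ.≤-refl cover
      where
      f≢? = λ z → ¬? (z ≟ᴰ f)
      us = filter f≢? directedEdges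
      cover : ∀ x → x ∈ us ⊎ Reachable f x
      cover x with x ≟ᴰ f
      ... | yes refl = inj₂ ([] , refl)
      ... | no x≢f   = inj₁ (∈-filter⁺ f≢? (directedEdges-complete x) x≢f)
    ... | vs , vs⊆ , cover , closed with cover e
    ...   | inj₂ f→e  = f→e
    ...   | inj₁ e∈vs = contradiction e∈vs (predecessorClosed closed f∉vs e⇝f)
      where
      f∉vs : f ∉ vs
      f∉vs f∈ = proj₂ (∈-filter⁻ (λ z → ¬? (z ≟ᴰ f)) {xs = directedEdges} (vs⊆ f∈)) refl

  two-elements : {A : Set} {xs : List A} → Unique xs → 2 ℕ.≤ length xs →
                 ∃[ x ] ∃[ y ] x ∈ xs × y ∈ xs × x ≢ y
  two-elements {xs = _ ∷ []}    _               (ℕ.s≤s ())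
  two-elements {xs = x ∷ y ∷ _} ((x≢y ∷ _) ∷ _) _ = x , y , here refl , there (here refl) , x≢y

  lookup-injective : {A : Set} {xs : List A} → Unique xs → ∀ i j → List.lookup xs i ≡ List.lookup xs j → i ≡ j
  lookup-injective (x∉ ∷ u) Fin.zero    Fin.zero    eq = refl
  lookup-injective (x∉ ∷ u) Fin.zero    (Fin.suc j) eq = contradiction eq (All.lookup x∉ (∈-lookup j))
  lookup-injective (x∉ ∷ u) (Fin.suc i) Fin.zero    eq = contradiction (sym eq) (All.lookup x∉ (∈-lookup i))
  lookup-injective (x∉ ∷ u) (Fin.suc i) (Fin.suc j) eq = cong Fin.suc (lookup-injective u i j eq)

  -- Exponentially many totally even closed walks for degree at least 3

  module Growth (G : Graph) (d : ℕ) (regular : NonBacktracking.Regular G d)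
    (connected : NonBacktracking.Connected G) (3≤d : 3 ℕ.≤ d) where

    open Graph G
    open NonBacktracking G
    open ClosedWalks G
    open RegularGraph G d regular
    open Walk _⇝_

    branching : ∀ e → ∃[ f ] ∃[ f′ ] e ⇝ f × e ⇝ f′ × f ≢ f′
    branching e =
      let f , f′ , f∈ , f′∈ , f≢f′ = two-elements (Unique.filter⁺ (e ⇝?_) directedEdges-unique)
            (subst (2 ℕ.≤_) (sym (length-successors e)) (ℕ.∸-monoˡ-≤ 1 3≤d))
      in f , f′ , proj₂ (∈-filter⁻ (e ⇝?_) {xs = directedEdges} f∈) ,
         proj₂ (∈-filter⁻ (e ⇝?_) {xs = directedEdges} f′∈) , f≢f′

    -- `f` and `f′` leave the same vertex, so `rev f` enters it and may turn into `f′`. Every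
    -- sideways entry into an earlier step arises in this way.
    siblings-⇝ : ∀ {e f f′} → e ⇝ f → e ⇝ f′ → f ≢ f′ → rev f ⇝ f′
    siblings-⇝ {f = f} (h≡t , _) (h≡t′ , _) f≢f′ = trans (head-rev f) (trans (sym h≡t) h≡t′) ,
      λ f′≡rrf → f≢f′ (trans (sym (rev-involutive f)) (sym f′≡rrf))

    -- e ⇝ f′, rev f ⇝ f′ and rev f ⇝ rev e, the middle step being taken backwards.
    reverse-reachable : ∀ e → Reachable e (rev e)
    reverse-reachable e with branching e
    ... | f , f′ , e⇝f , e⇝f′ , f≢f′ = reachable-trans (⇝⇒reachable e⇝f′)
      (reachable-trans (⇝⇒reachable-back (siblings-⇝ e⇝f e⇝f′ f≢f′)) (⇝⇒reachable (rev-⇝ {e} {f} e⇝f)))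

    adjacent-reachable : ∀ e f → head e ≡ tail f → Reachable e f
    adjacent-reachable e f h≡t with f ≟ᴰ rev e
    ... | yes refl   = reverse-reachable e
    ... | no f≢rev-e = ⇝⇒reachable (h≡t , f≢rev-e)

    -- A path of the graph between the end vertices may backtrack; wherever it does, a walk from the
    -- edge to its reversal is inserted.
    irreducible : ∀ e f → Reachable e f
    irreducible e f = along e refl (proj₂ connected (head e) (tail f))
      where
      along : ∀ e {u} → head e ≡ u → Star (λ x y → ∃[ e ] tail e ≡ x × head e ≡ y) u (tail f) → Reachable e f
      along e h≡u ε = adjacent-reachable e f h≡u
      along e h≡u ((g , t≡u , h≡v) ◅ s) =
        reachable-trans (adjacent-reachable e g (trans h≡u (sym t≡u))) (along g h≡v s)

    Passes : DirectedEdge → DirectedEdge → DirectedEdge → List DirectedEdge → Set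
    Passes x y e []       = ⊥
    Passes x y e (z ∷ zs) = (e ≡ x × z ≡ y) ⊎ Passes x y z zs

    passes-++ˡ : ∀ {x y} e ws {vs} → Passes x y e ws → Passes x y e (ws List.++ vs)
    passes-++ˡ e (z ∷ ws) (inj₁ p) = inj₁ p
    passes-++ˡ e (z ∷ ws) (inj₂ p) = inj₂ (passes-++ˡ z ws p)

    passes-++ʳ : ∀ {x y e f} ws {vs} → Path e ws f → Passes x y f vs → Passes x y e (ws List.++ vs)
    passes-++ʳ []       refl    p = p
    passes-++ʳ (z ∷ ws) (_ , π) p = inj₂ (passes-++ʳ ws π p)

    -- The pairs are visited one after the other by irreducibility. Pairs that are not steps are
    -- skipped, so that the list may later consist of all pairs of directed edges.
    passing-all : ∀ (ts : List (DirectedEdge × DirectedEdge)) e → ∃[ ws ] ∃[ f ] Path e ws f ×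
                  All (λ t → proj₁ t ⇝ proj₂ t → Passes (proj₁ t) (proj₂ t) e ws) ts
    passing-all []             e = [] , e , refl , []
    passing-all ((x , y) ∷ ts) e with x ⇝? y
    ... | no ¬x⇝y = let ws , f , π , p = passing-all ts e
                    in ws , f , π , (λ x⇝y → contradiction x⇝y ¬x⇝y) ∷ p
    ... | yes x⇝y =
      let us , π = irreducible e x
          ws , f , π′ , p = passing-all ts y
      in us List.++ y ∷ ws , f , path-++ us π (x⇝y , π′) ,
         (λ _ → passes-++ʳ us π (inj₁ (refl , refl))) ∷
         All.map (λ q r → passes-++ʳ us π (inj₂ (q r))) p

    covering : ∀ e → ∃[ ws ] ∃[ f ] Path e ws f × (∀ {x y} → x ⇝ y → Passes x y e ws)
    covering e =
      let ws , f , π , p = passing-all (cartesianProduct directedEdges directedEdges) e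
      in ws , f , π , λ {x} {y} → All.lookup p
           (∈-cartesianProduct⁺ (directedEdges-complete x) (directedEdges-complete y))

    occurrencesᴸ : Fin ∣E∣ → List DirectedEdge → ℕ
    occurrencesᴸ i xs = length (filter (λ e → edge e Fin.≟ i) xs)

    occurrencesᴸ-++ : ∀ i xs ys → occurrencesᴸ i (xs List.++ ys) ≡ occurrencesᴸ i xs ℕ.+ occurrencesᴸ i ys
    occurrencesᴸ-++ i xs ys = trans (cong length (List.filter-++ (λ e → edge e Fin.≟ i) xs ys))
                                    (List.length-++ (filter (λ e → edge e Fin.≟ i) xs))

    Even : List DirectedEdge → Set
    Even xs = ∀ i → 2 ∣ occurrencesᴸ i xs

    even-double : ∀ xs → Even (xs List.++ xs)
    even-double xs i = subst (2 ∣_) (sym (occurrencesᴸ-++ i xs xs)) (2∣n+n (occurrencesᴸ i xs))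

    occurrencesᴸ-rev : ∀ i e → occurrencesᴸ i (rev e ∷ []) ≡ occurrencesᴸ i (e ∷ [])
    occurrencesᴸ-rev i e with does (edge e Fin.≟ i)
    ... | true  = refl
    ... | false = refl

    -- `e` and `rev e` traverse the same undirected edge, so together they change each count by 0 or
    -- 2.
    even-bracket : ∀ e xs ys → Even xs → Even ys → Even (e ∷ xs List.++ rev e ∷ ys)
    even-bracket e xs ys p q i = subst (2 ∣_) (sym shuffle)
      (∣m∣n⇒∣m+n (∣m∣n⇒∣m+n (2∣n+n (occurrencesᴸ i (e ∷ []))) (p i)) (q i))
      where
      open +-*-Solver
      shuffle : occurrencesᴸ i (e ∷ xs List.++ rev e ∷ ys) ≡
        (occurrencesᴸ i (e ∷ []) ℕ.+ occurrencesᴸ i (e ∷ []) ℕ.+ occurrencesᴸ i xs) ℕ.+ occurrencesᴸ i ys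
      shuffle = trans (occurrencesᴸ-++ i (e ∷ xs) (rev e ∷ ys)) (trans
        (cong₂ ℕ._+_ (occurrencesᴸ-++ i (e ∷ []) xs)
          (trans (occurrencesᴸ-++ i (rev e ∷ []) ys) (cong (ℕ._+ occurrencesᴸ i ys) (occurrencesᴸ-rev i e))))
        (solve 3 (λ a b c → (a :+ b) :+ (a :+ c) := (a :+ a :+ b) :+ c) refl
          (occurrencesᴸ i (e ∷ [])) (occurrencesᴸ i xs) (occurrencesᴸ i ys)))

    path-linked : ∀ {e g y} ws → Path e ws g → g ⇝ y → Linked e ws y
    path-linked []       refl    l = l
    path-linked (z ∷ ws) (h , π) l = h , path-linked ws π l

    path-linked-++ : ∀ {e g y} ws {vs} → Path e ws g → Linked g vs y → Linked e (ws List.++ vs) y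
    path-linked-++ []       refl    l = l
    path-linked-++ (z ∷ ws) (h , π) l = h , path-linked-++ ws π l

    -- A way of turning round after `e ∷ ws`, up to the point where `rev e` can follow. The edge `e`
    -- is left out of the parity condition because `rev e` will pair with it. The length depends on
    -- that of `ws` alone, which makes all closed walks built from equally long continuations
    -- equally long.
    record Turn (e : DirectedEdge) (ws : List DirectedEdge) : Set where
      field
        remainder : List DirectedEdge
        linked    : Linked e (ws List.++ remainder) (rev e)
        even      : Even (ws List.++ remainder)
        length-≡  : length (ws List.++ remainder) ≡ length ws ℕ.+ length ws

      detour : List DirectedEdge
      detour = ws List.++ remainder

    -- The walk e ∷ ws ends by running into its earlier passage x ∷ y from the side:
    -- go once more round the loop so closed, and then back along the initial segment.
    turn : ∀ {x y e g} ws → Path e ws g → Passes x y e ws →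
           head g ≡ head x → g ≢ x → g ⇝ y → Turn e ws
    turn {x} {y} {g = g} (y ∷ ws) (x⇝y , π) (inj₁ (refl , refl)) h≡h g≢x g⇝y = record
      { remainder = y ∷ ws
      ; linked    = x⇝y , path-linked-++ ws π (g⇝y , path-linked ws π g⇝rev-x)
      ; even      = even-double (y ∷ ws)
      ; length-≡  = List.length-++ (y ∷ ws)
      }
      where
      -- The second round arrives at the head of `x` through `g` and not through `x`, so leaving by
      -- `rev x` does not backtrack.
      g⇝rev-x : g ⇝ rev x
      g⇝rev-x = h≡h , λ rx≡rg → g≢x (trans (sym (rev-involutive g))
                                      (trans (cong rev (sym rx≡rg)) (rev-involutive x)))
    turn {e = e} (z ∷ ws) (e⇝z , π) (inj₂ p) h≡h g≢x g⇝y = record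
      -- `rev z` undoes the step `e ⇝ z`; it pairs with `z`, so the parities survive.
      { remainder = T.remainder List.++ rev z ∷ []
      ; linked    = e⇝z , subst (λ v → Linked z v (rev e)) (List.++-assoc ws T.remainder (rev z ∷ []))
                      (linked-++⁺ T.detour [] T.linked (rev-⇝ {e} {z} e⇝z))
      ; even      = subst Even (cong (z ∷_) (List.++-assoc ws T.remainder (rev z ∷ [])))
                      (even-bracket z T.detour [] T.even (λ i → 2 ∣0))
      ; length-≡  = begin
          suc (length (ws List.++ T.remainder List.++ rev z ∷ []))
            ≡⟨ cong (λ v → suc (length v)) (List.++-assoc ws T.remainder (rev z ∷ [])) ⟨
          suc (length (T.detour List.++ rev z ∷ []))
            ≡⟨ cong suc (List.length-++ T.detour) ⟩
          suc (length T.detour ℕ.+ 1)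
            ≡⟨ cong suc (ℕ.+-comm (length T.detour) 1) ⟩
          suc (suc (length T.detour))
            ≡⟨ cong (λ n → suc (suc n)) T.length-≡ ⟩
          suc (suc (length ws ℕ.+ length ws))
            ≡⟨ cong suc (ℕ.+-suc (length ws) (length ws)) ⟨
          suc (length ws) ℕ.+ suc (length ws) ∎
      }
      where
      open ≡-Reasoning
      module T = Turn (turn ws π p h≡h g≢x g⇝y)

    -- Let `f` and `y` be two successors of the last edge `g`. Then `x = rev f` enters the same
    -- vertex as `g`, differs from `g` because `f` is not `rev g`, and `x ⇝ y` is a step already
    -- taken by the walk. So `g` meets that passage from the side.
    covering-turn : ∀ {e g} ws → Path e ws g → (∀ {x y} → x ⇝ y → Passes x y e ws) → Turn e ws
    covering-turn {e} {g} ws π passes with branching g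
    ... | f , y , g⇝f , g⇝y , f≢y = turn ws π (passes (siblings-⇝ g⇝f g⇝y f≢y))
      (trans (proj₁ g⇝f) (sym (head-rev f))) (λ { refl → proj₂ g⇝f (sym (rev-involutive f)) }) g⇝y

    D : ℕ
    D = d ℕ.∸ 1

    successor : DirectedEdge → Fin D → DirectedEdge
    successor e i = List.lookup (successors e) (Fin.cast (sym (length-successors e)) i)

    ⇝-successor : ∀ e i → e ⇝ successor e i
    ⇝-successor e i = proj₂ (∈-filter⁻ (e ⇝?_) {xs = directedEdges} (∈-lookup _))

    successor-injective : ∀ e {i j} → successor e i ≡ successor e j → i ≡ j
    successor-injective e {i} {j} eq = Fin.toℕ-injective (trans (sym (Fin.toℕ-cast _ i))
      (trans (cong Fin.toℕ (lookup-injective (Unique.filter⁺ (e ⇝?_) directedEdges-unique) _ _ eq))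
             (Fin.toℕ-cast _ j)))

    -- Each letter selects one of the `D` successors of the current edge; words over `Fin D` thus
    -- encode the non-backtracking continuations.
    follow : ∀ {n} → DirectedEdge → Vec (Fin D) n → List DirectedEdge
    follow e []      = []
    follow e (i ∷ v) = successor e i ∷ follow (successor e i) v

    follow-path : ∀ {n} e (v : Vec (Fin D) n) → ∃[ g ] Path e (follow e v) g
    follow-path e []      = e , refl
    follow-path e (i ∷ v) = let g , π = follow-path (successor e i) v in g , ⇝-successor e i , π

    length-follow : ∀ {n} e (v : Vec (Fin D) n) → length (follow e v) ≡ n
    length-follow e []      = refl
    length-follow e (i ∷ v) = cong suc (length-follow (successor e i) v)

    -- The suffixes may differ, since the remainder of a turn depends on the continuation before it.
    follow-injective : ∀ {n} e (v v′ : Vec (Fin D) n) {xs xs′} →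
      follow e v List.++ xs ≡ follow e v′ List.++ xs′ → v ≡ v′
    follow-injective e []      []        eq = refl
    follow-injective e (i ∷ v) (i′ ∷ v′) eq with successor-injective e (List.∷-injectiveˡ eq)
    ... | refl = cong (i ∷_) (follow-injective (successor e i) v v′ (List.∷-injectiveʳ eq))

    fromCycle : ∀ {n} e xs → length xs ≡ n → Linked e xs e → Even (e ∷ xs) →
                ∃[ w ] toList w ≡ e ∷ xs × EvenWalk {suc n} w
    fromCycle e xs refl l even = e ∷ Vec.fromList xs , cong (e ∷_) (Vec.toList∘fromList xs) ,
      Equivalence.from (closed⇔linked e (Vec.fromList xs))
        (subst (λ v → Linked e v e) (sym (Vec.toList∘fromList xs)) l) ,
      λ i → subst (2 ∣_) (sym (trans (count-toList (λ e → edge e Fin.≟ i) (e ∷ Vec.fromList xs))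
        (cong (λ v → occurrencesᴸ i (e ∷ v)) (Vec.toList∘fromList xs)))) (even i)

    module _ {e f : DirectedEdge} (start : List DirectedEdge) (start-path : Path e start f)
      (start-passes : ∀ {x y} → x ⇝ y → Passes x y e start)
      {return : List DirectedEdge} (back : Turn (rev e) return) where

      private
        module Back = Turn back

        outward : ∀ {n} → Vec (Fin D) n → List DirectedEdge
        outward v = start List.++ follow f v

        outward-turn : ∀ {n} (v : Vec (Fin D) n) → Turn e (outward v)
        outward-turn v = let g , π = follow-path f v in
          covering-turn (outward v) (path-++ start start-path π) (λ x⇝y → passes-++ˡ e start (start-passes x⇝y))

        excess : ℕ
        excess = length start ℕ.+ length return

        -- After `e` the walk goes out along `start` and the continuation, turns, and comes back to
        -- `rev e`; the fixed second turn then leads from `rev e` to its reversal `e`, where the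
        -- walk closes.
        cycle : ∀ {n} → Vec (Fin D) n → List DirectedEdge
        cycle v = Turn.detour (outward-turn v) List.++ rev e ∷ Back.detour

        length-cycle : ∀ {n} (v : Vec (Fin D) n) → length (cycle v) ≡ (excess ℕ.+ n) ℕ.+ suc (excess ℕ.+ n)
        length-cycle {n} v = begin
          length (cycle v)
            ≡⟨ List.length-++ (Turn.detour (outward-turn v)) ⟩
          length (Turn.detour (outward-turn v)) ℕ.+ suc (length Back.detour)
            ≡⟨ cong₂ (λ a b → a ℕ.+ suc b) (Turn.length-≡ (outward-turn v)) Back.length-≡ ⟩
          (length (outward v) ℕ.+ length (outward v)) ℕ.+ suc (b ℕ.+ b)
            ≡⟨ cong (λ m → (m ℕ.+ m) ℕ.+ suc (b ℕ.+ b))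
                 (trans (List.length-++ start) (cong (length start ℕ.+_) (length-follow f v))) ⟩
          ((a ℕ.+ n) ℕ.+ (a ℕ.+ n)) ℕ.+ suc (b ℕ.+ b)
            ≡⟨ solve 3 (λ a b n → ((a :+ n) :+ (a :+ n)) :+ (con 1 :+ (b :+ b)) :=
                                  ((a :+ b) :+ n) :+ (con 1 :+ ((a :+ b) :+ n))) refl a b n ⟩
          (excess ℕ.+ n) ℕ.+ suc (excess ℕ.+ n) ∎
          where
          open ≡-Reasoning
          open +-*-Solver
          a = length start
          b = length return

        walk : ∀ {n} (v : Vec (Fin D) n) →
               ∃[ w ] toList w ≡ e ∷ cycle v × EvenWalk {suc (excess ℕ.+ n ℕ.+ suc (excess ℕ.+ n))} w
        walk v = fromCycle e (cycle v) (length-cycle v)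
          (linked-++⁺ (Turn.detour (outward-turn v)) Back.detour (Turn.linked (outward-turn v))
            (subst (Linked (rev e) Back.detour) (rev-involutive e) Back.linked))
          (even-bracket e (Turn.detour (outward-turn v)) Back.detour (Turn.even (outward-turn v)) Back.even)

        walk-injective : ∀ {n} {v v′ : Vec (Fin D) n} → proj₁ (walk v) ≡ proj₁ (walk v′) → v ≡ v′
        walk-injective {_} {v} {v′} eq = follow-injective f v v′ (List.++-cancelˡ start _ _ (begin
          start List.++ follow f v List.++ r List.++ s    ≡⟨ reassoc v r ⟩
          cycle v    ≡⟨ List.∷-injectiveʳ (trans (sym (proj₁ (proj₂ (walk v))))
                          (trans (cong toList eq) (proj₁ (proj₂ (walk v′))))) ⟩
          cycle v′   ≡⟨ reassoc v′ r′ ⟨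
          start List.++ follow f v′ List.++ r′ List.++ s  ∎))
          where
          open ≡-Reasoning
          s = rev e ∷ Back.detour
          r = Turn.remainder (outward-turn v)
          r′ = Turn.remainder (outward-turn v′)
          reassoc : ∀ (v : Vec (Fin D) _) r →
                    start List.++ follow f v List.++ r List.++ s ≡ ((start List.++ follow f v) List.++ r) List.++ s
          reassoc v r = sym (trans (List.++-assoc (start List.++ follow f v) r s)
                                   (List.++-assoc start (follow f v) (r List.++ s)))

      growth-along : ∃[ C ] ∀ n → D ℕ.^ n ℕ.≤ Ev ((C ℕ.+ n) ℕ.+ (C ℕ.+ n))
      -- The closed walk has length 1 + 2(|start| + n) + 1 + 2|return|, that is, 2(1 + excess + n).
      growth-along = suc excess , λ n → begin
        D ℕ.^ n                                             ≡⟨ cong (ℕ._^ n) (List.length-tabulate {n = D} id) ⟨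
        length (allFin D) ℕ.^ n                             ≡⟨ length-vectors (allFin D) n ⟨
        length (vectors (allFin D) n)                       ≡⟨ List.length-map (λ v → proj₁ (walk v)) (vectors (allFin D) n) ⟨
        length (map (λ v → proj₁ (walk v)) (vectors (allFin D) n))
          ≤⟨ unique⇒length≤Ev (Unique.map⁺ walk-injective (vectors-unique (Unique.allFin⁺ D) n))
               (λ w∈ → even (∈-map⁻ (λ v → proj₁ (walk v)) w∈)) ⟩
        Ev ((suc excess ℕ.+ n) ℕ.+ (suc excess ℕ.+ n))     ∎
        where
        open ℕ.≤-Reasoning
        even : ∀ {n w} → ∃[ v ] v ∈ vectors (allFin D) n × w ≡ proj₁ (walk v) → EvenWalk w
        even (v , _ , refl) = proj₂ (proj₂ (walk v))

    growth : DirectedEdge → ∃[ C ] ∀ n → D ℕ.^ n ℕ.≤ Ev ((C ℕ.+ n) ℕ.+ (C ℕ.+ n))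
    growth e =
      let start , _ , start-path , start-passes = covering e
          return , _ , return-path , return-passes = covering (rev e)
      in growth-along start start-path start-passes (covering-turn return return-path return-passes)

module Analysis where

  open import Algebra.Bundles.Raw using (RawRing)
  import Algebra.Properties.CommutativeSemiring.Exp as Exp
  open import Data.Nat.Coprimality as Coprimality using (1-coprimeTo)
  open import Data.Nat.Solver using () renaming (module +-*-Solver to ℕ-Solver)
  open import Data.Rational.Base
    using (mkℚ; 0ℚ; 1ℚ; ½; _+_; _*_; _-_; -_; _≤_; _<_; *≤*; Positive; positive; nonNegative; 1/_; ∣_∣)
  open import Data.Rational.Solver using (module +-*-Solver)

  -- Rational arithmetic

  module ℚ-exp = Exp (CommutativeRing.commutativeSemiring ℚ.+-*-commutativeRing)
  open ℚ-exp using (_^_)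

  private
    -- Integers as fractions whose denominator is 1 by construction, on which the operations of ℚ
    -- unfold to integer operations.
    whole : ℤ → ℚ
    whole i = mkℚ i 0 (Coprimality.sym (1-coprimeTo ℤ.∣ i ∣))

    /1≡whole : ∀ i → i ℚ./ 1 ≡ whole i
    /1≡whole i = ℚ.↥p/↧p≡p (whole i)

  -- Abstract, because unfolding the normalisation of fractions is expensive.
  abstract

    ℤ→ℚ : ℤ → ℚ
    ℤ→ℚ i = i ℚ./ 1

    ℤ→ℚ≡/1 : ∀ i → ℤ→ℚ i ≡ i ℚ./ 1
    ℤ→ℚ≡/1 i = refl

    ℤ→ℚ-+ : ∀ i j → ℤ→ℚ (i ℤ.+ j) ≡ ℤ→ℚ i + ℤ→ℚ j
    ℤ→ℚ-+ i j = sym (trans (cong₂ _+_ (/1≡whole i) (/1≡whole j))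
      (cong ℤ→ℚ (cong₂ ℤ._+_ (ℤ.*-identityʳ i) (ℤ.*-identityʳ j))))

    ℤ→ℚ-* : ∀ i j → ℤ→ℚ (i ℤ.* j) ≡ ℤ→ℚ i * ℤ→ℚ j
    ℤ→ℚ-* i j = sym (cong₂ _*_ (/1≡whole i) (/1≡whole j))

    ℤ→ℚ-mono-≤ : ∀ {i j} → i ℤ.≤ j → ℤ→ℚ i ≤ ℤ→ℚ j
    ℤ→ℚ-mono-≤ {i} {j} i≤j = subst₂ _≤_ (sym (/1≡whole i)) (sym (/1≡whole j))
      (*≤* (subst₂ ℤ._≤_ (sym (ℤ.*-identityʳ i)) (sym (ℤ.*-identityʳ j)) i≤j))

  ℕ→ℚ : ℕ → ℚ
  ℕ→ℚ n = ℤ→ℚ (ℤ.+ n)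

  ℕ→ℚ-0 : ℕ→ℚ 0 ≡ 0ℚ
  ℕ→ℚ-0 = ℤ→ℚ≡/1 (ℤ.+ 0)

  ℕ→ℚ-1 : ℕ→ℚ 1 ≡ 1ℚ
  ℕ→ℚ-1 = ℤ→ℚ≡/1 (ℤ.+ 1)

  ℕ→ℚ-mono-≤ : ∀ {m n} → m ℕ.≤ n → ℕ→ℚ m ≤ ℕ→ℚ n
  ℕ→ℚ-mono-≤ m≤n = ℤ→ℚ-mono-≤ (ℤ.+≤+ m≤n)

  ℕ→ℚ-suc : ∀ n → ℕ→ℚ (suc n) ≡ 1ℚ + ℕ→ℚ n
  ℕ→ℚ-suc n = trans (ℤ→ℚ-+ (ℤ.+ 1) (ℤ.+ n)) (cong (_+ ℕ→ℚ n) ℕ→ℚ-1)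

  ℕ→ℚ-* : ∀ m n → ℕ→ℚ (m ℕ.* n) ≡ ℕ→ℚ m * ℕ→ℚ n
  ℕ→ℚ-* m n = trans (cong ℤ→ℚ (ℤ.pos-* m n)) (ℤ→ℚ-* (ℤ.+ m) (ℤ.+ n))

  ℕ→ℚ-^ : ∀ m k → ℕ→ℚ (m ℕ.^ k) ≡ ℕ→ℚ m ^ k
  ℕ→ℚ-^ m zero    = ℕ→ℚ-1
  ℕ→ℚ-^ m (suc k) = trans (ℕ→ℚ-* m (m ℕ.^ k)) (cong (ℕ→ℚ m *_) (ℕ→ℚ-^ m k))

  0≤ℕ→ℚ : ∀ n → 0ℚ ≤ ℕ→ℚ n
  0≤ℕ→ℚ n = subst (_≤ ℕ→ℚ n) ℕ→ℚ-0 (ℕ→ℚ-mono-≤ ℕ.z≤n)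

  ℕ→ℚ-mono-< : ∀ {m n} → m ℕ.< n → ℕ→ℚ m < ℕ→ℚ n
  ℕ→ℚ-mono-< {m} m<n = ℚ.<-≤-trans
    (subst (ℕ→ℚ m <_) (sym (ℕ→ℚ-suc m)) (subst (_< 1ℚ + ℕ→ℚ m) (ℚ.+-identityˡ (ℕ→ℚ m))
      (ℚ.+-monoˡ-< (ℕ→ℚ m) (ℚ.positive⁻¹ 1ℚ)))) (ℕ→ℚ-mono-≤ m<n)

  ℕ→ℚ-suc-positive : ∀ n → Positive (ℕ→ℚ (suc n))
  ℕ→ℚ-suc-positive n = positive (ℚ.≤-<-trans (0≤ℕ→ℚ n) (ℕ→ℚ-mono-< (ℕ.n<1+n n)))

  archimedean : ∀ p → p ≤ ℕ→ℚ ℤ.∣ ℚ.numerator p ∣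
  archimedean p@(mkℚ i d _) = subst (p ≤_) (sym (trans (ℤ→ℚ≡/1 (ℤ.+ ℤ.∣ i ∣)) (/1≡whole (ℤ.+ ℤ.∣ i ∣)))) (*≤* (begin
    i ℤ.* ℤ.1ℤ                    ≡⟨ ℤ.*-identityʳ i ⟩
    i                             ≤⟨ i≤∣i∣ i ⟩
    ℤ.+ ℤ.∣ i ∣                   ≤⟨ ℤ.+≤+ (ℕ.m≤m*n ℤ.∣ i ∣ (suc d)) ⟩
    ℤ.+ (ℤ.∣ i ∣ ℕ.* suc d)       ≡⟨ ℤ.pos-* ℤ.∣ i ∣ (suc d) ⟩
    ℤ.+ ℤ.∣ i ∣ ℤ.* ℤ.+ suc d         ∎))
    where
    open ℤ.≤-Reasoning
    i≤∣i∣ : ∀ i → i ℤ.≤ ℤ.+ ℤ.∣ i ∣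
    i≤∣i∣ (ℤ.+ n)      = ℤ.≤-refl
    i≤∣i∣ (ℤ.-[1+ n ]) = ℤ.-≤+

  0≤+ : ∀ {p q} → 0ℚ ≤ p → 0ℚ ≤ q → 0ℚ ≤ p + q
  0≤+ = ℚ.+-mono-≤

  *-monoˡ : ∀ {p q} r → 0ℚ ≤ r → p ≤ q → r * p ≤ r * q
  *-monoˡ r 0≤r = ℚ.*-monoˡ-≤-nonNeg r {{nonNegative 0≤r}}

  *-monoʳ : ∀ {p q} r → 0ℚ ≤ r → p ≤ q → p * r ≤ q * r
  *-monoʳ r 0≤r = ℚ.*-monoʳ-≤-nonNeg r {{nonNegative 0≤r}}

  0≤* : ∀ {p q} → 0ℚ ≤ p → 0ℚ ≤ q → 0ℚ ≤ p * q
  0≤* {p} {q} 0≤p 0≤q = subst (_≤ p * q) (ℚ.*-zeroʳ p) (*-monoˡ p 0≤p 0≤q)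

  0<* : ∀ {p q} → 0ℚ < p → 0ℚ < q → 0ℚ < p * q
  0<* {p} {q} 0<p 0<q = ℚ.positive⁻¹ (p * q) {{ℚ.pos*pos⇒pos p {{positive 0<p}} q {{positive 0<q}}}}

  *-mono-≤ : ∀ {p q r s} → 0ℚ ≤ p → 0ℚ ≤ r → p ≤ q → r ≤ s → p * r ≤ q * s
  *-mono-≤ {q = q} {r} 0≤p 0≤r p≤q r≤s = ℚ.≤-trans (*-monoʳ r 0≤r p≤q) (*-monoˡ q (ℚ.≤-trans 0≤p p≤q) r≤s)

  p≤q+p : ∀ {p q} → 0ℚ ≤ q → p ≤ q + p
  p≤q+p {p} {q} 0≤q = subst (_≤ q + p) (ℚ.+-identityˡ p) (ℚ.+-monoˡ-≤ p 0≤q)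

  p≤p+q : ∀ {p q} → 0ℚ ≤ q → p ≤ p + q
  p≤p+q {p} {q} 0≤q = subst (_≤ p + q) (ℚ.+-identityʳ p) (ℚ.+-monoʳ-≤ p 0≤q)

  0≤p² : ∀ p → 0ℚ ≤ p * p
  0≤p² p = subst (0ℚ ≤_) (∣p∣*∣p∣ (ℚ.∣p∣≡p∨∣p∣≡-p p)) (0≤* (ℚ.0≤∣p∣ p) (ℚ.0≤∣p∣ p))
    where
    open +-*-Solver
    ∣p∣*∣p∣ : _ → ∣ p ∣ * ∣ p ∣ ≡ p * p
    ∣p∣*∣p∣ (inj₁ eq) = cong₂ _*_ eq eq
    ∣p∣*∣p∣ (inj₂ eq) = trans (cong₂ _*_ eq eq) (solve 1 (λ p → (:- p) :* (:- p) := p :* p) refl p)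

  0≤^ : ∀ {p} k → 0ℚ ≤ p → 0ℚ ≤ p ^ k
  0≤^ zero    _   = ℚ.<⇒≤ (ℚ.positive⁻¹ 1ℚ)
  0≤^ (suc k) 0≤p = 0≤* 0≤p (0≤^ k 0≤p)

  ^-monoˡ-≤ : ∀ {p q} k → 0ℚ ≤ p → p ≤ q → p ^ k ≤ q ^ k
  ^-monoˡ-≤ zero    _   _   = ℚ.≤-refl
  ^-monoˡ-≤ (suc k) 0≤p p≤q = *-mono-≤ 0≤p (0≤^ k 0≤p) p≤q (^-monoˡ-≤ k 0≤p p≤q)

  ^-cancelˡ-< : ∀ {p q} k → 0ℚ ≤ q → p ^ k < q ^ k → p < q
  ^-cancelˡ-< k 0≤q p^k<q^k = ℚ.≰⇒> λ q≤p → ℚ.<-irrefl refl (ℚ.<-≤-trans p^k<q^k (^-monoˡ-≤ k 0≤q q≤p))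

  ∣p∣≤ : ∀ {p q} → p ≤ q → - p ≤ q → ∣ p ∣ ≤ q
  ∣p∣≤ {p} p≤q -p≤q with ℚ.∣p∣≡p∨∣p∣≡-p p
  ... | inj₁ eq = subst (_≤ _) (sym eq) p≤q
  ... | inj₂ eq = subst (_≤ _) (sym eq) -p≤q

  p≤∣p∣ : ∀ p → p ≤ ∣ p ∣
  p≤∣p∣ p with ℚ.∣p∣≡p∨∣p∣≡-p p
  ... | inj₁ eq = ℚ.≤-reflexive (sym eq)
  ... | inj₂ eq = ℚ.≮⇒≥ λ ∣p∣<p → ℚ.<-irrefl refl (ℚ.<-≤-trans
    (ℚ.≤-<-trans (ℚ.0≤∣p∣ p) ∣p∣<p) (subst (_≤ 0ℚ) (trans (cong -_ eq) (neg-neg p)) (ℚ.neg-antimono-≤ (ℚ.0≤∣p∣ p))))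
    where
    open +-*-Solver
    neg-neg : ∀ p → - (- p) ≡ p
    neg-neg = solve 1 (λ p → :- (:- p) := p) refl

  ≤+⇒-≤ : ∀ p q {r} → p ≤ q + r → p - q ≤ r
  ≤+⇒-≤ p q {r} p≤q+r = subst (p - q ≤_) (solve 2 (λ q r → q :+ r :- q := r) refl q r) (ℚ.+-monoˡ-≤ (- q) p≤q+r)
    where open +-*-Solver

  -≤⇒≤+ : ∀ p q {r} → p - q ≤ r → p ≤ q + r
  -≤⇒≤+ p q {r} p-q≤r = subst₂ _≤_ (solve 2 (λ p q → q :+ (p :- q) := p) refl p q) refl (ℚ.+-monoʳ-≤ q p-q≤r)
    where open +-*-Solver

  ∣p-q∣≤ : ∀ p q {r} → p ≤ q + r → q ≤ p + r → ∣ p - q ∣ ≤ r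
  ∣p-q∣≤ p q {r} p≤ q≤ = ∣p∣≤ (≤+⇒-≤ p q p≤)
    (subst (_≤ r) (solve 2 (λ p q → q :- p := :- (p :- q)) refl p q) (≤+⇒-≤ q p q≤))
    where open +-*-Solver

  -- Roots of natural numbers as Cauchy sequences

  abstract

    1/1+_ : ℕ → ℚ
    1/1+ m = (1/ ℕ→ℚ (suc m)) {{ℚ.pos⇒nonZero (ℕ→ℚ (suc m)) {{ℕ→ℚ-suc-positive m}}}}

    0<1/1+ : ∀ m → 0ℚ < 1/1+ m
    0<1/1+ m = ℚ.positive⁻¹ (1/1+ m) {{ℚ.1/pos⇒pos (ℕ→ℚ (suc m)) {{ℕ→ℚ-suc-positive m}}}}

    [1+m]*1/1+m : ∀ m → ℕ→ℚ (suc m) * 1/1+ m ≡ 1ℚ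
    [1+m]*1/1+m m = ℚ.*-inverseʳ (ℕ→ℚ (suc m)) {{ℚ.pos⇒nonZero (ℕ→ℚ (suc m)) {{ℕ→ℚ-suc-positive m}}}}

  0≤1/1+ : ∀ m → 0ℚ ≤ 1/1+ m
  0≤1/1+ m = ℚ.<⇒≤ (0<1/1+ m)

  eventually-≤* : ∀ L ε → 0ℚ < ε → ∃[ N ] ∀ n → N ℕ.≤ n → L ≤ ε * ℕ→ℚ n
  eventually-≤* L ε 0<ε = N , λ n N≤n → begin
    L                 ≡⟨ ℚ.*-identityˡ L ⟨
    1ℚ * L            ≡⟨ cong (_* L) (ℚ.*-inverseʳ ε) ⟨
    ε * 1/ ε * L      ≡⟨ ℚ.*-assoc ε (1/ ε) L ⟩
    ε * (1/ ε * L)    ≤⟨ *-monoˡ ε (ℚ.<⇒≤ 0<ε) (archimedean (1/ ε * L)) ⟩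
    ε * ℕ→ℚ N         ≤⟨ *-monoˡ ε (ℚ.<⇒≤ 0<ε) (ℕ→ℚ-mono-≤ N≤n) ⟩
    ε * ℕ→ℚ n         ∎
    where
    open ℚ.≤-Reasoning
    instance
      ε≢0 : ℚ.NonZero ε
      ε≢0 = ℚ.pos⇒nonZero ε {{positive 0<ε}}
    N = ℤ.∣ ℚ.numerator (1/ ε * L) ∣

  eventually-1/1+*≤ : ∀ L ε → 0ℚ < ε → ∃[ N ] ∀ n → N ℕ.≤ n → 1/1+ n * L ≤ ε
  eventually-1/1+*≤ L ε 0<ε = let N , bound = eventually-≤* L ε 0<ε in N , λ n N≤n → begin
    1/1+ n * L                        ≤⟨ *-monoˡ (1/1+ n) (0≤1/1+ n) (bound (suc n) (ℕ.m≤n⇒m≤1+n N≤n)) ⟩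
    1/1+ n * (ε * ℕ→ℚ (suc n))        ≡⟨ rotate (1/1+ n) ε (ℕ→ℚ (suc n)) ⟩
    ε * (ℕ→ℚ (suc n) * 1/1+ n)        ≡⟨ cong (ε *_) ([1+m]*1/1+m n) ⟩
    ε * 1ℚ                            ≡⟨ ℚ.*-identityʳ ε ⟩
    ε                                 ∎
    where
    open ℚ.≤-Reasoning
    open +-*-Solver
    rotate : ∀ a b c → a * (b * c) ≡ b * (c * a)
    rotate = solve 3 (λ a b c → a :* (b :* c) := b :* (c :* a)) refl

  eventually-1/1+≤ : ∀ ε → 0ℚ < ε → ∃[ N ] ∀ n → N ℕ.≤ n → 1/1+ n ≤ ε
  eventually-1/1+≤ ε 0<ε = let N , bound = eventually-1/1+*≤ 1ℚ ε 0<ε in N , λ n N≤n → subst (_≤ ε) (ℚ.*-identityʳ (1/1+ n)) (bound n N≤n)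

  -- Built up along `N`: the integer part of the root rises by at most one when `N` does.
  floorRoot : ∀ k N → ∃[ a ] a ℕ.^ suc k ℕ.≤ N × N ℕ.< suc a ℕ.^ suc k
  floorRoot k zero    = 0 , ℕ.≤-refl , ℕ.≤-reflexive (sym (ℕ.^-zeroˡ (suc k)))
  floorRoot k (suc N) with floorRoot k N
  ... | a , a^k≤N , N<a+1^k with suc a ℕ.^ suc k ℕ.≤? suc N
  ...   | yes a+1^k≤ = suc a , a+1^k≤ , ℕ.≤-<-trans N<a+1^k (ℕ.^-monoˡ-< (suc k) (ℕ.n<1+n (suc a)))
  ...   | no  a+1^k≰ = a , ℕ.m≤n⇒m≤1+n a^k≤N , ℕ.≰⇒> a+1^k≰

  module _ (n k : ℕ) where

    private
      scaled : ∀ m → ∃[ a ] a ℕ.^ suc k ℕ.≤ n ℕ.* suc m ℕ.^ suc k × n ℕ.* suc m ℕ.^ suc k ℕ.< suc a ℕ.^ suc k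
      scaled m = floorRoot k (n ℕ.* suc m ℕ.^ suc k)

      descale : ∀ m → ℕ→ℚ (n ℕ.* suc m ℕ.^ suc k) * (1/1+ m) ^ suc k ≡ ℕ→ℚ n
      descale m = begin
        ℕ→ℚ (n ℕ.* suc m ℕ.^ suc k) * δ ^ suc k        ≡⟨ cong (_* δ ^ suc k) (trans (ℕ→ℚ-* n (suc m ℕ.^ suc k))
                                                            (cong (ℕ→ℚ n *_) (ℕ→ℚ-^ (suc m) (suc k)))) ⟩
        ℕ→ℚ n * ℕ→ℚ (suc m) ^ suc k * δ ^ suc k        ≡⟨ ℚ.*-assoc (ℕ→ℚ n) (ℕ→ℚ (suc m) ^ suc k) (δ ^ suc k) ⟩
        ℕ→ℚ n * (ℕ→ℚ (suc m) ^ suc k * δ ^ suc k)      ≡⟨ cong (ℕ→ℚ n *_) (ℚ-exp.^-distrib-* (ℕ→ℚ (suc m)) δ (suc k)) ⟨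
        ℕ→ℚ n * (ℕ→ℚ (suc m) * δ) ^ suc k              ≡⟨ cong (λ x → ℕ→ℚ n * x ^ suc k) ([1+m]*1/1+m m) ⟩
        ℕ→ℚ n * 1ℚ ^ suc k                             ≡⟨ cong (ℕ→ℚ n *_) (1^ (suc k)) ⟩
        ℕ→ℚ n * 1ℚ                                     ≡⟨ ℚ.*-identityʳ (ℕ→ℚ n) ⟩
        ℕ→ℚ n                                          ∎
        where
        open ≡-Reasoning
        δ = 1/1+ m
        1^ : ∀ j → 1ℚ ^ j ≡ 1ℚ
        1^ zero    = refl
        1^ (suc j) = trans (ℚ.*-identityˡ (1ℚ ^ j)) (1^ j)

    -- The m-th term is ⌊(n (m + 1)^k′)^(1/k′)⌋ / (m + 1) with k′ = k + 1.
    rootSeq : ℕ → ℚ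
    rootSeq m = ℕ→ℚ (proj₁ (scaled m)) * 1/1+ m

    0≤rootSeq : ∀ m → 0ℚ ≤ rootSeq m
    0≤rootSeq m = 0≤* (0≤ℕ→ℚ (proj₁ (scaled m))) (0≤1/1+ m)

    rootSeq-lower : ∀ m → rootSeq m ^ suc k ≤ ℕ→ℚ n
    rootSeq-lower m = begin
      (ℕ→ℚ a * δ) ^ suc k                        ≡⟨ ℚ-exp.^-distrib-* (ℕ→ℚ a) δ (suc k) ⟩
      ℕ→ℚ a ^ suc k * δ ^ suc k                  ≡⟨ cong (_* δ ^ suc k) (ℕ→ℚ-^ a (suc k)) ⟨
      ℕ→ℚ (a ℕ.^ suc k) * δ ^ suc k              ≤⟨ *-monoʳ (δ ^ suc k) (0≤^ (suc k) (0≤1/1+ m))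
                                                      (ℕ→ℚ-mono-≤ (proj₁ (proj₂ (scaled m)))) ⟩
      ℕ→ℚ (n ℕ.* suc m ℕ.^ suc k) * δ ^ suc k    ≡⟨ descale m ⟩
      ℕ→ℚ n                                      ∎
      where
      open ℚ.≤-Reasoning
      a = proj₁ (scaled m)
      δ = 1/1+ m

    rootSeq-upper : ∀ m → ℕ→ℚ n < (rootSeq m + 1/1+ m) ^ suc k
    rootSeq-upper m = begin-strict
      ℕ→ℚ n                                      ≡⟨ descale m ⟨
      ℕ→ℚ (n ℕ.* suc m ℕ.^ suc k) * δ ^ suc k    <⟨ ℚ.*-monoˡ-<-pos (δ ^ suc k) {{positive (0<^ (suc k))}}
                                                      (ℕ→ℚ-mono-< (proj₂ (proj₂ (scaled m)))) ⟩
      ℕ→ℚ (suc a ℕ.^ suc k) * δ ^ suc k          ≡⟨ cong (_* δ ^ suc k) (ℕ→ℚ-^ (suc a) (suc k)) ⟩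
      ℕ→ℚ (suc a) ^ suc k * δ ^ suc k            ≡⟨ ℚ-exp.^-distrib-* (ℕ→ℚ (suc a)) δ (suc k) ⟨
      (ℕ→ℚ (suc a) * δ) ^ suc k                  ≡⟨ cong (_^ suc k) (trans (cong (_* δ) (ℕ→ℚ-suc a))
                                                      (expand (ℕ→ℚ a) δ)) ⟩
      (rootSeq m + δ) ^ suc k                    ∎
      where
      open ℚ.≤-Reasoning
      open +-*-Solver
      a = proj₁ (scaled m)
      δ = 1/1+ m
      expand : ∀ a δ → (1ℚ + a) * δ ≡ a * δ + δ
      expand = solve 2 (λ a δ → (con 1ℚ :+ a) :* δ := a :* δ :+ δ) refl
      0<^ : ∀ j → 0ℚ < δ ^ j
      0<^ zero    = ℚ.positive⁻¹ 1ℚ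
      0<^ (suc j) = 0<* (0<1/1+ m) (0<^ j)

    -- The power of the `l`-th term is at most `n`, that of the enlarged `m`-th term exceeds it, and
    -- powers reflect the order. As this holds for all `l` and `m`, it yields the Cauchy modulus
    -- without reference to a limit.
    rootSeq-compare : ∀ l m → rootSeq l ≤ rootSeq m + 1/1+ m
    rootSeq-compare l m = ℚ.<⇒≤ (^-cancelˡ-< (suc k) (0≤+ (0≤rootSeq m) (0≤1/1+ m))
      (ℚ.≤-<-trans (rootSeq-lower l) (rootSeq-upper m)))

    rootᴿ : ℝ
    rootᴿ .seq = rootSeq
    rootᴿ .cauchy ε 0<ε = let N , small = eventually-1/1+≤ ε 0<ε in N , λ l m N≤l N≤m → ∣p-q∣≤ (rootSeq l) (rootSeq m)
      (ℚ.≤-trans (rootSeq-compare l m) (ℚ.+-monoʳ-≤ (rootSeq m) (small m N≤m)))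
      (ℚ.≤-trans (rootSeq-compare m l) (ℚ.+-monoʳ-≤ (rootSeq l) (small l N≤l)))

  seq-^ᴿ : ∀ x k n → seq (x ^ᴿ k) n ≡ seq x n ^ k
  seq-^ᴿ x zero    n = refl
  seq-^ᴿ x (suc k) n = cong (seq x n *_) (seq-^ᴿ x k n)

  -- A Lipschitz constant for the power on [0, b], built by the product rule. It bounds how far the
  -- power of a truncated root can fall short of `n`.
  ^-lipschitz : ∀ b → 0ℚ ≤ b → ∀ k → ∃[ L ] 0ℚ ≤ L ×
    (∀ {p δ} → 0ℚ ≤ p → 0ℚ ≤ δ → p + δ ≤ b → (p + δ) ^ k ≤ p ^ k + δ * L)
  ^-lipschitz b 0≤b zero    = 0ℚ , ℚ.≤-refl , λ {_} {δ} _ _ _ →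
    ℚ.≤-reflexive (sym (trans (cong (_+_ 1ℚ) (ℚ.*-zeroʳ δ)) (ℚ.+-identityʳ 1ℚ)))
  ^-lipschitz b 0≤b (suc k) = let L , 0≤L , bound = ^-lipschitz b 0≤b k in
    b ^ k + b * L , 0≤+ (0≤^ k 0≤b) (0≤* 0≤b 0≤L) , λ {p} {δ} 0≤p 0≤δ p+δ≤b →
    let p≤b = ℚ.≤-trans (p≤p+q 0≤δ) p+δ≤b in begin
    (p + δ) * (p + δ) ^ k                  ≤⟨ *-monoˡ (p + δ) (0≤+ 0≤p 0≤δ) (bound 0≤p 0≤δ p+δ≤b) ⟩
    (p + δ) * (p ^ k + δ * L)              ≡⟨ expand p δ (p ^ k) L ⟩
    p * p ^ k + δ * (p ^ k + (p + δ) * L)  ≤⟨ ℚ.+-monoʳ-≤ (p * p ^ k) (*-monoˡ δ 0≤δ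
                                                (ℚ.+-mono-≤ (^-monoˡ-≤ k 0≤p p≤b) (*-monoʳ L 0≤L p+δ≤b))) ⟩
    p * p ^ k + δ * (b ^ k + b * L)        ∎
    where
    open ℚ.≤-Reasoning
    open +-*-Solver
    expand : ∀ p δ q L → (p + δ) * (q + δ * L) ≡ p * q + δ * (q + (p + δ) * L)
    expand = solve 4 (λ p δ q L → (p :+ δ) :* (q :+ δ :* L) := p :* q :+ δ :* (q :+ (p :+ δ) :* L)) refl

  rootᴿ-isRoot : ∀ n k → IsRoot (suc k) (fromℕ n) (rootᴿ n k)
  rootᴿ-isRoot n k = (λ ε 0<ε → 0 , λ m _ → 0≤+ (0≤rootSeq n k m) (ℚ.<⇒≤ 0<ε)) , power
    where
    s = rootSeq n k
    -- By `rootSeq-compare` every term is at most `s 0 + 1/1+ 0`; the last summand leaves room for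
    -- the error `1/1+ m`.
    b = s 0 + 1/1+ 0 + 1ℚ
    0≤1 = ℚ.<⇒≤ (ℚ.positive⁻¹ 1ℚ)
    power : rootᴿ n k ^ᴿ suc k ≈ᴿ fromℕ n
    power ε 0<ε =
      let L , _ , bound = ^-lipschitz b (0≤+ (0≤+ (0≤rootSeq n k 0) (0≤1/1+ 0)) 0≤1) (suc k)
          N , small = eventually-1/1+*≤ L ε 0<ε
          N′ , ≤1 = eventually-1/1+≤ 1ℚ (ℚ.positive⁻¹ 1ℚ)
      in N ℕ.⊔ N′ , λ m ≤m → subst₂ (λ x y → ∣ x - y ∣ ≤ ε)
        (sym (seq-^ᴿ (rootᴿ n k) (suc k) m)) (ℤ→ℚ≡/1 (ℤ.+ n))
        (∣p-q∣≤ (s m ^ suc k) (ℕ→ℚ n)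
          (ℚ.≤-trans (rootSeq-lower n k m) (p≤p+q (ℚ.<⇒≤ 0<ε)))
          (begin
            ℕ→ℚ n                        ≤⟨ ℚ.<⇒≤ (rootSeq-upper n k m) ⟩
            (s m + 1/1+ m) ^ suc k       ≤⟨ bound (0≤rootSeq n k m) (0≤1/1+ m)
                                              (ℚ.+-mono-≤ (rootSeq-compare n k m 0) (≤1 m (ℕ.m⊔n≤o⇒n≤o N N′ ≤m))) ⟩
            s m ^ suc k + 1/1+ m * L     ≤⟨ ℚ.+-monoʳ-≤ (s m ^ suc k) (small m (ℕ.m⊔n≤o⇒m≤o N N′ ≤m)) ⟩
            s m ^ suc k + ε              ∎))
      where open ℚ.≤-Reasoning

  -- The lower limit of the roots

  bernoulli : ∀ {t η} → 0ℚ ≤ t → 0ℚ ≤ η → ∀ j → t ^ j * (t + ℕ→ℚ j * η) ≤ t * (t + η) ^ j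
  bernoulli {t} {η} 0≤t 0≤η zero = ℚ.≤-reflexive
    (trans (cong (λ x → 1ℚ * (t + x * η)) ℕ→ℚ-0) (simplify t η))
    where
    open +-*-Solver
    simplify : ∀ t η → 1ℚ * (t + 0ℚ * η) ≡ t * 1ℚ
    simplify = solve 2 (λ t η → con 1ℚ :* (t :+ con 0ℚ :* η) := t :* con 1ℚ) refl
  bernoulli {t} {η} 0≤t 0≤η (suc j) = begin
    t * x * (t + ℕ→ℚ (suc j) * η)                     ≡⟨ cong (λ J → t * x * (t + J * η)) (ℕ→ℚ-suc j) ⟩
    t * x * (t + (1ℚ + J) * η)                        ≤⟨ p≤p+q (0≤* (0≤^ j 0≤t) (0≤* (0≤ℕ→ℚ j) (0≤* 0≤η 0≤η))) ⟩
    t * x * (t + (1ℚ + J) * η) + x * (J * (η * η))    ≡⟨ factor t η x J ⟩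
    (t + η) * (x * (t + J * η))                       ≤⟨ *-monoˡ (t + η) (0≤+ 0≤t 0≤η) (bernoulli 0≤t 0≤η j) ⟩
    (t + η) * (t * (t + η) ^ j)                       ≡⟨ swap (t + η) t ((t + η) ^ j) ⟩
    t * ((t + η) * (t + η) ^ j)                       ∎
    where
    open ℚ.≤-Reasoning
    open +-*-Solver
    x = t ^ j
    J = ℕ→ℚ j
    factor : ∀ t η x J → t * x * (t + (1ℚ + J) * η) + x * (J * (η * η)) ≡ (t + η) * (x * (t + J * η))
    factor = solve 4 (λ t η x J → t :* x :* (t :+ (con 1ℚ :+ J) :* η) :+ x :* (J :* (η :* η)) :=
                                  (t :+ η) :* (x :* (t :+ J :* η))) refl
    swap : ∀ a b c → a * (b * c) ≡ b * (a * c)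
    swap = solve 3 (λ a b c → a :* (b :* c) := b :* (a :* c)) refl

  -- Put u = t + η, so that u² ≤ D and u^(2(C+n)) ≤ D^C D^n. By Bernoulli's inequality (1 + η/t)^j ≥
  -- 1 + jη/t, stated above cleared of denominators, (u/t)^j grows without bound and in the end
  -- exceeds the constant D^C.
  eventually-^≤ : ∀ {t η} D C → 1 ℕ.≤ D → 0ℚ < t → 0ℚ < η → (t + η) * (t + η) ≤ ℕ→ℚ D →
    ∃[ N ] ∀ n → N ℕ.≤ n → t ^ ((C ℕ.+ n) ℕ.+ (C ℕ.+ n)) ≤ ℕ→ℚ (D ℕ.^ n)
  eventually-^≤ {t} {η} D C 1≤D 0<t 0<η u²≤D =
    let N , large = eventually-≤* (t * E) η 0<η in N , λ n N≤n →
    let k = C ℕ.+ n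
        j = k ℕ.+ k
        n≤j = ℕ.≤-trans (ℕ.m≤n+m n C) (ℕ.m≤m+n k k)
    in ℚ.*-cancelʳ-≤-pos (t * E) {{positive (0<* 0<t 0<E)}} (begin
      t ^ j * (t * E)                  ≤⟨ *-monoˡ (t ^ j) (0≤^ j 0≤t) (large n N≤n) ⟩
      t ^ j * (η * ℕ→ℚ n)              ≤⟨ *-monoˡ (t ^ j) (0≤^ j 0≤t) (*-monoˡ η 0≤η (ℕ→ℚ-mono-≤ n≤j)) ⟩
      t ^ j * (η * ℕ→ℚ j)              ≡⟨ cong (t ^ j *_) (ℚ.*-comm η (ℕ→ℚ j)) ⟩
      t ^ j * (ℕ→ℚ j * η)              ≤⟨ *-monoˡ (t ^ j) (0≤^ j 0≤t) (p≤q+p 0≤t) ⟩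
      t ^ j * (t + ℕ→ℚ j * η)          ≤⟨ bernoulli 0≤t 0≤η j ⟩
      t * u ^ j                        ≡⟨ cong (t *_) (trans (ℚ-exp.^-homo-* u k k) (sym (ℚ-exp.^-distrib-* u u k))) ⟩
      t * (u * u) ^ k                  ≤⟨ *-monoˡ t 0≤t (^-monoˡ-≤ k (0≤p² u) u²≤D) ⟩
      t * ℕ→ℚ D ^ k                    ≡⟨ cong (t *_) (ℚ-exp.^-homo-* (ℕ→ℚ D) C n) ⟩
      t * (ℕ→ℚ D ^ C * ℕ→ℚ D ^ n)      ≡⟨ cong₂ (λ a b → t * (a * b)) (ℕ→ℚ-^ D C) (ℕ→ℚ-^ D n) ⟨
      t * (E * ℕ→ℚ (D ℕ.^ n))          ≡⟨ rotate t E (ℕ→ℚ (D ℕ.^ n)) ⟩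
      ℕ→ℚ (D ℕ.^ n) * (t * E)          ∎)
    where
    open ℚ.≤-Reasoning
    u = t + η
    E = ℕ→ℚ (D ℕ.^ C)
    0≤t = ℚ.<⇒≤ 0<t
    0≤η = ℚ.<⇒≤ 0<η
    0<E : 0ℚ < E
    0<E = subst (_< E) ℕ→ℚ-0 (ℕ→ℚ-mono-< (ℕ.≤-trans (ℕ.≤-reflexive (sym (ℕ.^-zeroˡ C))) (ℕ.^-monoˡ-≤ C 1≤D)))
    rotate : ∀ a b c → a * (b * c) ≡ c * (a * b)
    rotate = solve 3 (λ a b c → a :* (b :* c) := c :* (a :* b)) refl
      where open +-*-Solver

  -- The value at ℓ = 0 is junk.
  roots : (ℕ → ℕ) → ℕ → ℝ
  roots f zero    = fromℕ 0
  roots f (suc ℓ) = rootᴿ (f (suc ℓ)) ℓ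

  roots-isRoot : ∀ f ℓ → 1 ℕ.≤ ℓ → IsRoot ℓ (fromℕ (f ℓ)) (roots f ℓ)
  roots-isRoot f (suc ℓ) _ = rootᴿ-isRoot (f (suc ℓ)) ℓ

  0≤roots : ∀ f ℓ n → 0ℚ ≤ seq (roots f ℓ) n
  0≤roots f zero    n = ℚ.≤-refl
  0≤roots f (suc ℓ) n = 0≤rootSeq (f (suc ℓ)) ℓ n

  ^≤⇒≤roots : ∀ {t} f ℓ → 1 ℕ.≤ ℓ → t ^ ℓ ≤ ℕ→ℚ (f ℓ) → ∀ n → t ≤ seq (roots f ℓ) n + 1/1+ n
  ^≤⇒≤roots f (suc ℓ) _ t^ℓ≤ n = ℚ.<⇒≤ (^-cancelˡ-< (suc ℓ)
    (0≤+ (0≤rootSeq (f (suc ℓ)) ℓ n) (0≤1/1+ n)) (ℚ.≤-<-trans t^ℓ≤ (rootSeq-upper (f (suc ℓ)) ℓ n)))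

  -- A rational t is put between `q` and √D, so that powers are compared in ℚ. If t ≤ 0, the bound
  -- holds because roots are non-negative; t > 0 forces `D ≥ 1`, and only then is `growth` called
  -- upon.
  liminf-roots : ∀ (f : ℕ → ℕ) D → (1 ℕ.≤ D → ∃[ C ] ∀ n → D ℕ.^ n ℕ.≤ f ((C ℕ.+ n) ℕ.+ (C ℕ.+ n))) →
    rootᴿ D 1 ≤liminfᵉᵛᵉⁿ roots f
  liminf-roots f D growth q (ε , 0<ε , N₁ , gap) = bound (0ℚ ℚ.<? t)
    where
    s = rootSeq D 1
    η = ½ * ε
    0<η : 0ℚ < η
    0<η = 0<* (ℚ.positive⁻¹ ½) 0<ε
    m = proj₁ (eventually-1/1+≤ η 0<η)
    -- From q + 2η ≤ s n ≤ s m + η follows q ≤ t, while t + η = s m is still at most √D.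
    t = s m - η
    ε≡η+η : η + η ≡ ε
    ε≡η+η = trans (sym (ℚ.*-distribʳ-+ ε ½ ½)) (ℚ.*-identityˡ ε)

    q≤t : ∀ n → N₁ ℕ.≤ n → seq q n ≤ t
    q≤t n N₁≤n = subst₂ _≤_ (cancelˡ (seq q n) η) (cancelʳ (s m) η)
      (ℚ.+-monoˡ-≤ (- (η + η)) (begin
        seq q n + (η + η)     ≡⟨ cong (seq q n +_) ε≡η+η ⟩
        seq q n + ε           ≤⟨ gap n N₁≤n ⟩
        s n                   ≤⟨ rootSeq-compare D 1 n m ⟩
        s m + 1/1+ m          ≤⟨ ℚ.+-monoʳ-≤ (s m) (proj₂ (eventually-1/1+≤ η 0<η) m ℕ.≤-refl) ⟩
        s m + η               ∎))
      where
      open ℚ.≤-Reasoning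
      open +-*-Solver
      cancelˡ : ∀ a b → a + (b + b) + - (b + b) ≡ a
      cancelˡ = solve 2 (λ a b → a :+ (b :+ b) :+ :- (b :+ b) := a) refl
      cancelʳ : ∀ a b → a + b + - (b + b) ≡ a - b
      cancelʳ = solve 2 (λ a b → a :+ b :+ :- (b :+ b) := a :- b) refl

    t+η≡s : t + η ≡ s m
    t+η≡s = cancel (s m) η
      where
      open +-*-Solver
      cancel : ∀ a b → a - b + b ≡ a
      cancel = solve 2 (λ a b → a :- b :+ b := a) refl

    u²≤D : (t + η) * (t + η) ≤ ℕ→ℚ D
    u²≤D = subst (_≤ ℕ→ℚ D) (cong₂ _*_ (sym t+η≡s) (trans (ℚ.*-identityʳ (s m)) (sym t+η≡s)))
                 (rootSeq-lower D 1 m)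

    1≤D : 0ℚ < t → 1 ℕ.≤ D
    1≤D 0<t = ℕ.≰⇒> λ D≤0 → ℚ.<-irrefl refl (ℚ.<-≤-trans (0<* 0<u 0<u)
      (ℚ.≤-trans u²≤D (ℚ.≤-trans (ℕ→ℚ-mono-≤ D≤0) (ℚ.≤-reflexive ℕ→ℚ-0))))
      where
      0<u : 0ℚ < t + η
      0<u = ℚ.+-mono-< 0<t 0<η

    bound : Dec (0ℚ < t) → ∃[ N ] ∀ ℓ → N ℕ.≤ ℓ → 2 ∣ ℓ → q ≤ᴿ roots f ℓ
    bound (no t≤0) = 0 , λ ℓ _ _ ε′ 0<ε′ → N₁ , λ n N₁≤n →
      ℚ.≤-trans (q≤t n N₁≤n) (ℚ.≤-trans (ℚ.≮⇒≥ t≤0) (0≤+ (0≤roots f ℓ n) (ℚ.<⇒≤ 0<ε′)))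
    bound (yes 0<t) =
      let C , grows = growth (1≤D 0<t)
          N , powers = eventually-^≤ D C (1≤D 0<t) 0<t 0<η u²≤D
          t≤roots : ∀ k → C ℕ.+ suc N ℕ.≤ k → ∀ n → t ≤ seq (roots f (k ℕ.+ k)) n + 1/1+ n
          t≤roots k C+N<k =
            let C≤k = ℕ.m+n≤o⇒m≤o C C+N<k
                N<k∸C = ℕ.≤-trans (ℕ.≤-reflexive (sym (ℕ.m+n∸m≡n C (suc N)))) (ℕ.∸-monoˡ-≤ C C+N<k)
            in subst (λ k → ∀ n → t ≤ seq (roots f (k ℕ.+ k)) n + 1/1+ n) (ℕ.m+[n∸m]≡n C≤k)
                 (^≤⇒≤roots f _
                   (ℕ.≤-trans (ℕ.≤-trans (ℕ.≤-trans (ℕ.s≤s ℕ.z≤n) N<k∸C) (ℕ.m≤n+m (k ℕ.∸ C) C))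
                              (ℕ.m≤m+n (C ℕ.+ (k ℕ.∸ C)) _))
                   (ℚ.≤-trans (powers (k ℕ.∸ C) (ℕ.<⇒≤ N<k∸C)) (ℕ→ℚ-mono-≤ (grows (k ℕ.∸ C)))))
      -- Here ℓ = 2k and n = k - C. The successor on `N` keeps ℓ positive, away from the junk value
      -- of `roots`.
      in (C ℕ.+ suc N) ℕ.* 2 , λ { ℓ N≤ℓ (divides k refl) ε′ 0<ε′ →
           let N₂ , small = eventually-1/1+≤ ε′ 0<ε′ in N₁ ℕ.⊔ N₂ , λ n ≤n → begin
             seq q n                                    ≤⟨ q≤t n (ℕ.m⊔n≤o⇒m≤o N₁ N₂ ≤n) ⟩
             t                                          ≤⟨ t≤roots k (ℕ.*-cancelʳ-≤ _ k 2 N≤ℓ) n ⟩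
             seq (roots f (k ℕ.+ k)) n + 1/1+ n         ≡⟨ cong (λ ℓ → seq (roots f ℓ) n + 1/1+ n) (k+k≡k*2 k) ⟩
             seq (roots f (k ℕ.* 2)) n + 1/1+ n         ≤⟨ ℚ.+-monoʳ-≤ (seq (roots f (k ℕ.* 2)) n)
                                                             (small n (ℕ.m⊔n≤o⇒n≤o N₁ N₂ ≤n)) ⟩
             seq (roots f (k ℕ.* 2)) n + ε′             ∎ }
      where
      open ℚ.≤-Reasoning
      k+k≡k*2 : ∀ k → k ℕ.+ k ≡ k ℕ.* 2
      k+k≡k*2 = solve 1 (λ k → k :+ k := k :* con 2) refl
        where open ℕ-Solver

  -- Weighted Cauchy-Schwarz and Schur's test

  module ℚ-∑ = SumProperties ℚ.+-*-commutativeRing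

  ∑ℚ : {A : Set} → List A → (A → ℚ) → ℚ
  ∑ℚ = Sum.∑ ℚ.+-*-rawRing

  ∑ℝ : {A : Set} → List A → (A → ℝ) → ℝ
  ∑ℝ = Sum.∑ ℝ-rawRing

  ∑ℂ : {A : Set} → List A → (A → ℂ) → ℂ
  ∑ℂ = Sum.∑ ℂ-rawRing

  open RawRing ℂ-rawRing using () renaming (_≈_ to _≈ᶜ_; _*_ to _*ᶜ_; 0# to 0ᶜ; 1# to 1ᶜ)

  module _ {A : Set} where

    ∑ℚ-mono-≤ : (xs : List A) {f g : A → ℚ} → (∀ x → f x ≤ g x) → ∑ℚ xs f ≤ ∑ℚ xs g
    ∑ℚ-mono-≤ []       f≤g = ℚ.≤-refl
    ∑ℚ-mono-≤ (x ∷ xs) f≤g = ℚ.+-mono-≤ (f≤g x) (∑ℚ-mono-≤ xs f≤g)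

    0≤∑ℚ : (xs : List A) {f : A → ℚ} → (∀ x → 0ℚ ≤ f x) → 0ℚ ≤ ∑ℚ xs f
    0≤∑ℚ []       0≤f = ℚ.≤-refl
    0≤∑ℚ (x ∷ xs) 0≤f = 0≤+ (0≤f x) (0≤∑ℚ xs 0≤f)

    term≤∑ℚ : {xs : List A} {f : A → ℚ} → (∀ x → 0ℚ ≤ f x) → ∀ {x} → x ∈ xs → f x ≤ ∑ℚ xs f
    term≤∑ℚ {x ∷ xs} 0≤f (here refl) = p≤p+q (0≤∑ℚ xs 0≤f)
    term≤∑ℚ {x ∷ xs} 0≤f (there x∈)  = ℚ.≤-trans (term≤∑ℚ 0≤f x∈) (p≤q+p (0≤f x))

    ℤ→ℚ-∑ : (xs : List A) (f : A → ℤ) → ℤ→ℚ (Sum.∑ ℤ.+-*-rawRing xs f) ≡ ∑ℚ xs (λ x → ℤ→ℚ (f x))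
    ℤ→ℚ-∑ []       f = ℕ→ℚ-0
    ℤ→ℚ-∑ (x ∷ xs) f = trans (ℤ→ℚ-+ (f x) _) (cong (ℤ→ℚ (f x) +_) (ℤ→ℚ-∑ xs f))

    seq-∑ℝ : (xs : List A) (f : A → ℝ) → ∀ n → seq (∑ℝ xs f) n ≡ ∑ℚ xs (λ x → seq (f x) n)
    seq-∑ℝ []       f n = refl
    seq-∑ℝ (x ∷ xs) f n = cong (seq (f x) n +_) (seq-∑ℝ xs f n)

    seq-re-∑ℂ : (xs : List A) (f : A → ℂ) → ∀ n → seq (re (∑ℂ xs f)) n ≡ ∑ℚ xs (λ x → seq (re (f x)) n)
    seq-re-∑ℂ []       f n = refl
    seq-re-∑ℂ (x ∷ xs) f n = cong (seq (re (f x)) n +_) (seq-re-∑ℂ xs f n)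

    seq-im-∑ℂ : (xs : List A) (f : A → ℂ) → ∀ n → seq (im (∑ℂ xs f)) n ≡ ∑ℚ xs (λ x → seq (im (f x)) n)
    seq-im-∑ℂ []       f n = refl
    seq-im-∑ℂ (x ∷ xs) f n = cong (seq (im (f x)) n +_) (seq-im-∑ℂ xs f n)

    module _ {w : A → ℚ} (0≤w : ∀ x → 0ℚ ≤ w x) (r : A → ℚ) where

      private
        β μ κ : List A → ℚ
        β xs = ∑ℚ xs w
        μ xs = ∑ℚ xs (λ x → w x * r x)
        κ xs = ∑ℚ xs (λ x → w x * (r x * r x))

        spread : ∀ c xs → ∑ℚ xs (λ x → w x * ((r x - c) * (r x - c))) ≡ κ xs + c * c * β xs - (c + c) * μ xs
        spread c []       = sym (empty c)
          where
          open +-*-Solver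
          empty : ∀ c → 0ℚ + c * c * 0ℚ - (c + c) * 0ℚ ≡ 0ℚ
          empty = solve 1 (λ c → con 0ℚ :+ c :* c :* con 0ℚ :- (c :+ c) :* con 0ℚ := con 0ℚ) refl
        spread c (x ∷ xs) = trans (cong (w x * ((r x - c) * (r x - c)) +_) (spread c xs))
          (collect (w x) (r x) c (κ xs) (β xs) (μ xs))
          where
          open +-*-Solver
          collect : ∀ w r c κ β μ → w * ((r - c) * (r - c)) + (κ + c * c * β - (c + c) * μ) ≡
                    w * (r * r) + κ + c * c * (w + β) - (c + c) * (w * r + μ)
          collect = solve 6 (λ w r c κ β μ → w :* ((r :- c) :* (r :- c)) :+ (κ :+ c :* c :* β :- (c :+ c) :* μ) :=
                    w :* (r :* r) :+ κ :+ c :* c :* (w :+ β) :- (c :+ c) :* (w :* r :+ μ)) refl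

      -- Induction on the list, free of roots and division: adding a term of weight p and value c
      -- leaves, besides the inequality for the tail, the slack p ∑ w (r - c)² ≥ 0, which `spread`
      -- expands.
      cauchy-schwarz : ∀ xs → μ xs * μ xs ≤ β xs * κ xs
      cauchy-schwarz []       = ℚ.≤-refl
      cauchy-schwarz (x ∷ xs) = begin
        (p * c + m) * (p * c + m)
          ≤⟨ p≤p+q (0≤* (0≤w x) (0≤∑ℚ xs (λ y → 0≤* (0≤w y) (0≤p² (r y - c))))) ⟩
        (p * c + m) * (p * c + m) + p * ∑ℚ xs (λ y → w y * ((r y - c) * (r y - c)))
          ≡⟨ cong (λ s → (p * c + m) * (p * c + m) + p * s) (spread c xs) ⟩
        (p * c + m) * (p * c + m) + p * (k + c * c * b - (c + c) * m)
          ≡⟨ collect p c m k b ⟩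
        p * (p * (c * c) + k) + b * (p * (c * c)) + m * m
          ≤⟨ ℚ.+-monoʳ-≤ (p * (p * (c * c) + k) + b * (p * (c * c))) (cauchy-schwarz xs) ⟩
        p * (p * (c * c) + k) + b * (p * (c * c)) + b * k
          ≡⟨ factor p c k b ⟩
        (p + b) * (p * (c * c) + k) ∎
        where
        open ℚ.≤-Reasoning
        open +-*-Solver
        p = w x
        c = r x
        b = β xs
        m = μ xs
        k = κ xs
        collect : ∀ p c m k b → (p * c + m) * (p * c + m) + p * (k + c * c * b - (c + c) * m) ≡
                  p * (p * (c * c) + k) + b * (p * (c * c)) + m * m
        collect = solve 5 (λ p c m k b → (p :* c :+ m) :* (p :* c :+ m) :+ p :* (k :+ c :* c :* b :- (c :+ c) :* m) :=
                  p :* (p :* (c :* c) :+ k) :+ b :* (p :* (c :* c)) :+ m :* m) refl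
        factor : ∀ p c k b → p * (p * (c * c) + k) + b * (p * (c * c)) + b * k ≡ (p + b) * (p * (c * c) + k)
        factor = solve 4 (λ p c k b → p :* (p :* (c :* c) :+ k) :+ b :* (p :* (c :* c)) :+ b :* k :=
                                      (p :+ b) :* (p :* (c :* c) :+ k)) refl

  -- Schur's test: Cauchy–Schwarz in every row, with the entries as weights.
  schur : {A : Set} (xs : List A) {b : A → A → ℚ} {s : ℚ} → (∀ x y → 0ℚ ≤ b x y) →
    (∀ x → ∑ℚ xs (b x) ≡ s) → (∀ y → ∑ℚ xs (λ x → b x y) ≡ s) → 0ℚ ≤ s → ∀ (r : A → ℚ) →
    ∑ℚ xs (λ x → ∑ℚ xs (λ y → b x y * r y) * ∑ℚ xs (λ y → b x y * r y)) ≤ s * s * ∑ℚ xs (λ x → r x * r x)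
  schur xs {b} {s} 0≤b rows columns 0≤s r = begin
    ∑ℚ xs (λ x → ∑ℚ xs (λ y → b x y * r y) * ∑ℚ xs (λ y → b x y * r y))
      ≤⟨ ∑ℚ-mono-≤ xs (λ x → cauchy-schwarz (0≤b x) r xs) ⟩
    ∑ℚ xs (λ x → ∑ℚ xs (b x) * ∑ℚ xs (λ y → b x y * r² y))
      ≡⟨ ℚ-∑.∑-cong xs (λ x → cong (_* ∑ℚ xs (λ y → b x y * r² y)) (rows x)) ⟩
    ∑ℚ xs (λ x → s * ∑ℚ xs (λ y → b x y * r² y))
      ≡⟨ ℚ-∑.*-distribˡ-∑ xs s _ ⟨
    s * ∑ℚ xs (λ x → ∑ℚ xs (λ y → b x y * r² y))
      ≡⟨ cong (s *_) (ℚ-∑.∑-swap xs xs (λ x y → b x y * r² y)) ⟩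
    s * ∑ℚ xs (λ y → ∑ℚ xs (λ x → b x y * r² y))
      ≡⟨ cong (s *_) (ℚ-∑.∑-cong xs (λ y → trans (sym (ℚ-∑.*-distribʳ-∑ xs (r² y) (λ x → b x y)))
                                                (cong (_* r² y) (columns y)))) ⟩
    s * ∑ℚ xs (λ y → s * r² y)
      ≡⟨ cong (s *_) (ℚ-∑.*-distribˡ-∑ xs s r²) ⟨
    s * (s * ∑ℚ xs r²)
      ≡⟨ ℚ.*-assoc s s (∑ℚ xs r²) ⟨
    s * s * ∑ℚ xs r² ∎
    where
    open ℚ.≤-Reasoning
    r² = λ x → r x * r x

  -- Equality and order of Cauchy sequences

  pointwise⇒≈ᴿ : ∀ {x y} → (∀ n → seq x n ≡ seq y n) → x ≈ᴿ y
  pointwise⇒≈ᴿ {x} {y} x≗y ε 0<ε = 0 , λ n _ → ∣p-q∣≤ (seq x n) (seq y n)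
    (ℚ.≤-trans (ℚ.≤-reflexive (x≗y n)) (p≤p+q (ℚ.<⇒≤ 0<ε)))
    (ℚ.≤-trans (ℚ.≤-reflexive (sym (x≗y n))) (p≤p+q (ℚ.<⇒≤ 0<ε)))

  ∣p-q∣≤⇒p≤q+ : ∀ p q {r} → ∣ p - q ∣ ≤ r → p ≤ q + r
  ∣p-q∣≤⇒p≤q+ p q ∣p-q∣≤r = -≤⇒≤+ p q (ℚ.≤-trans (p≤∣p∣ (p - q)) ∣p-q∣≤r)

  ∣p-q∣≤⇒q≤p+ : ∀ p q {r} → ∣ p - q ∣ ≤ r → q ≤ p + r
  ∣p-q∣≤⇒q≤p+ p q {r} ∣p-q∣≤r = ∣p-q∣≤⇒p≤q+ q p (subst (_≤ r) (trans (sym (ℚ.∣-p∣≡∣p∣ (p - q))) (cong ∣_∣ (flip p q))) ∣p-q∣≤r)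
    where
    open +-*-Solver
    flip : ∀ p q → - (p - q) ≡ q - p
    flip = solve 2 (λ p q → :- (p :- q) := q :- p) refl

  ½*ε+½*ε : ∀ ε → ½ * ε + ½ * ε ≡ ε
  ½*ε+½*ε ε = trans (sym (ℚ.*-distribʳ-+ ε ½ ½)) (ℚ.*-identityˡ ε)

  +ᴿ-cong : ∀ {x x′ y y′} → x ≈ᴿ x′ → y ≈ᴿ y′ → x +ᴿ y ≈ᴿ x′ +ᴿ y′
  +ᴿ-cong {x} {x′} {y} {y′} x≈x′ y≈y′ ε 0<ε =
    let N , closeˣ = x≈x′ (½ * ε) (0<* (ℚ.positive⁻¹ ½) 0<ε)
        M , closeʸ = y≈y′ (½ * ε) (0<* (ℚ.positive⁻¹ ½) 0<ε)
    in N ℕ.⊔ M , λ n ≤n → subst (_ ≤_) (½*ε+½*ε ε) (begin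
      ∣ (seq x n + seq y n) - (seq x′ n + seq y′ n) ∣
        ≡⟨ cong ∣_∣ (regroup (seq x n) (seq y n) (seq x′ n) (seq y′ n)) ⟩
      ∣ (seq x n - seq x′ n) + (seq y n - seq y′ n) ∣
        ≤⟨ ℚ.∣p+q∣≤∣p∣+∣q∣ (seq x n - seq x′ n) (seq y n - seq y′ n) ⟩
      ∣ seq x n - seq x′ n ∣ + ∣ seq y n - seq y′ n ∣
        ≤⟨ ℚ.+-mono-≤ (closeˣ n (ℕ.m⊔n≤o⇒m≤o N M ≤n)) (closeʸ n (ℕ.m⊔n≤o⇒n≤o N M ≤n)) ⟩
      ½ * ε + ½ * ε ∎)
    where
    open ℚ.≤-Reasoning
    open +-*-Solver
    regroup : ∀ a b c d → (a + b) - (c + d) ≡ (a - c) + (b - d)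
    regroup = solve 4 (λ a b c d → (a :+ b) :- (c :+ d) := (a :- c) :+ (b :- d)) refl

  eventually-bounded : ∀ x → ∃[ K ] 0ℚ < K × ∃[ N ] ∀ n → N ℕ.≤ n → ∣ seq x n ∣ ≤ K
  eventually-bounded x =
    let N , close = cauchy x 1ℚ (ℚ.positive⁻¹ 1ℚ) in
    1ℚ + ∣ seq x N ∣ , ℚ.+-mono-<-≤ (ℚ.positive⁻¹ 1ℚ) (ℚ.0≤∣p∣ (seq x N)) , N , λ n N≤n → begin
      ∣ seq x n ∣                              ≡⟨ cong ∣_∣ (split (seq x n) (seq x N)) ⟩
      ∣ (seq x n - seq x N) + seq x N ∣        ≤⟨ ℚ.∣p+q∣≤∣p∣+∣q∣ (seq x n - seq x N) (seq x N) ⟩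
      ∣ seq x n - seq x N ∣ + ∣ seq x N ∣      ≤⟨ ℚ.+-monoˡ-≤ ∣ seq x N ∣ (close n N N≤n ℕ.≤-refl) ⟩
      1ℚ + ∣ seq x N ∣                         ∎
    where
    open ℚ.≤-Reasoning
    open +-*-Solver
    split : ∀ a b → a ≡ (a - b) + b
    split = solve 2 (λ a b → a := (a :- b) :+ b) refl

  square-cong : ∀ {x y} → x ≈ᴿ y → x *ᴿ x ≈ᴿ y *ᴿ y
  square-cong {x} {y} x≈y ε 0<ε =
    let K , 0<K , N , bounded = eventually-bounded (x +ᴿ y)
        δ , 0<δ , δK≡ε = divide K 0<K
        M , close = x≈y δ 0<δ
    in N ℕ.⊔ M , λ n ≤n → subst (_ ≤_) δK≡ε (begin
      ∣ seq x n * seq x n - seq y n * seq y n ∣       ≡⟨ cong ∣_∣ (factor (seq x n) (seq y n)) ⟩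
      ∣ (seq x n - seq y n) * (seq x n + seq y n) ∣   ≡⟨ ℚ.∣p*q∣≡∣p∣*∣q∣ (seq x n - seq y n) (seq x n + seq y n) ⟩
      ∣ seq x n - seq y n ∣ * ∣ seq x n + seq y n ∣   ≤⟨ *-mono-≤ (ℚ.0≤∣p∣ (seq x n - seq y n)) (ℚ.0≤∣p∣ (seq x n + seq y n))
                                                          (close n (ℕ.m⊔n≤o⇒n≤o N M ≤n)) (bounded n (ℕ.m⊔n≤o⇒m≤o N M ≤n)) ⟩
      δ * K                                           ∎)
    where
    open ℚ.≤-Reasoning
    open +-*-Solver
    factor : ∀ a b → a * a - b * b ≡ (a - b) * (a + b)
    factor = solve 2 (λ a b → a :* a :- b :* b := (a :- b) :* (a :+ b)) refl
    divide : ∀ K → 0ℚ < K → ∃[ δ ] 0ℚ < δ × δ * K ≡ ε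
    divide K 0<K = ε * 1/ K , 0<* 0<ε (ℚ.positive⁻¹ (1/ K) {{ℚ.1/pos⇒pos K}}) ,
      trans (ℚ.*-assoc ε (1/ K) K) (trans (cong (ε *_) (ℚ.*-inverseˡ K)) (ℚ.*-identityʳ ε))
      where instance
        K-pos : ℚ.Positive K
        K-pos = positive 0<K
        K-nonZero : ℚ.NonZero K
        K-nonZero = ℚ.pos⇒nonZero K

  ∑ℝ-cong : {A : Set} (xs : List A) {f g : A → ℝ} → (∀ x → f x ≈ᴿ g x) → ∑ℝ xs f ≈ᴿ ∑ℝ xs g
  ∑ℝ-cong []       {f} {g} f≈g = pointwise⇒≈ᴿ {∑ℝ [] f} {∑ℝ [] g} (λ _ → refl)
  ∑ℝ-cong (x ∷ xs) {f} {g} f≈g = +ᴿ-cong {f x} {g x} {∑ℝ xs f} {∑ℝ xs g} (f≈g x) (∑ℝ-cong xs f≈g)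

  ∣∣²-cong : ∀ {z w} → z ≈ᶜ w → ∣ z ∣² ≈ᴿ ∣ w ∣²
  ∣∣²-cong {z} {w} (re≈ , im≈) = +ᴿ-cong {re z *ᴿ re z} {re w *ᴿ re w} {im z *ᴿ im z} {im w *ᴿ im w}
    (square-cong {re z} {re w} re≈) (square-cong {im z} {im w} im≈)

  -- The order is decided on rationals, at an index N from which both sequences stay within η = ε/5.
  -- If x_N ≤ y_N + 3η, then x ≤ y + 5η; otherwise two of the three η pay for the deviations and y +
  -- η ≤ x remains, a strict inequality.
  ≮ᴿ⇒≥ᴿ : ∀ x y → ¬ y <ᴿ x → x ≤ᴿ y
  ≮ᴿ⇒≥ᴿ x y y≮x ε 0<ε = decide (seq x N ℚ.≤? seq y N + (η + η + η))
    where
    η = (ℤ.+ 1 ℚ./ 5) * ε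
    0<η : 0ℚ < η
    0<η = 0<* (ℚ.positive⁻¹ (ℤ.+ 1 ℚ./ 5)) 0<ε
    Nˣ = proj₁ (cauchy x η 0<η)
    Nʸ = proj₁ (cauchy y η 0<η)
    N = Nˣ ℕ.⊔ Nʸ
    closeˣ : ∀ n → N ℕ.≤ n → ∣ seq x n - seq x N ∣ ≤ η
    closeˣ n N≤n = proj₂ (cauchy x η 0<η) n N (ℕ.m⊔n≤o⇒m≤o Nˣ Nʸ N≤n) (ℕ.m≤m⊔n Nˣ Nʸ)
    closeʸ : ∀ n → N ℕ.≤ n → ∣ seq y n - seq y N ∣ ≤ η
    closeʸ n N≤n = proj₂ (cauchy y η 0<η) n N (ℕ.m⊔n≤o⇒n≤o Nˣ Nʸ N≤n) (ℕ.m≤n⊔m Nˣ Nʸ)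
    open ℚ.≤-Reasoning
    open +-*-Solver
    fifths : ∀ a ε → a + (ℤ.+ 1 ℚ./ 5) * ε + ((ℤ.+ 1 ℚ./ 5) * ε + (ℤ.+ 1 ℚ./ 5) * ε + (ℤ.+ 1 ℚ./ 5) * ε) + (ℤ.+ 1 ℚ./ 5) * ε ≡ a + ε
    fifths = solve 2 (λ a ε → let f = con (ℤ.+ 1 ℚ./ 5) in
      a :+ f :* ε :+ (f :* ε :+ f :* ε :+ f :* ε) :+ f :* ε := a :+ ε) refl
    regroup : ∀ b η → b + η + η + η ≡ b + (η + η + η)
    regroup = solve 2 (λ b η → b :+ η :+ η :+ η := b :+ (η :+ η :+ η)) refl
    cancel : ∀ a b → a + b - b ≡ a
    cancel = solve 2 (λ a b → a :+ b :- b := a) refl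
    decide : Dec (seq x N ≤ seq y N + (η + η + η)) → ∃[ N ] ∀ n → N ℕ.≤ n → seq x n ≤ seq y n + ε
    decide (yes xN≤yN) = N , λ n N≤n → begin
      seq x n                              ≤⟨ ∣p-q∣≤⇒p≤q+ (seq x n) (seq x N) (closeˣ n N≤n) ⟩
      seq x N + η                          ≤⟨ ℚ.+-monoˡ-≤ η xN≤yN ⟩
      seq y N + (η + η + η) + η            ≤⟨ ℚ.+-monoˡ-≤ η (ℚ.+-monoˡ-≤ (η + η + η) (∣p-q∣≤⇒q≤p+ (seq y n) (seq y N) (closeʸ n N≤n))) ⟩
      seq y n + η + (η + η + η) + η        ≡⟨ fifths (seq y n) ε ⟩
      seq y n + ε                          ∎
    decide (no xN≰yN) = contradiction (η , 0<η , N , λ n N≤n → subst₂ _≤_ (cancel (seq y n + η) η) (cancel (seq x n) η)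
      (ℚ.+-monoˡ-≤ (- η) (begin
        seq y n + η + η          ≤⟨ ℚ.+-monoˡ-≤ η (ℚ.+-monoˡ-≤ η (∣p-q∣≤⇒p≤q+ (seq y n) (seq y N) (closeʸ n N≤n))) ⟩
        seq y N + η + η + η      ≡⟨ regroup (seq y N) η ⟩
        seq y N + (η + η + η)    ≤⟨ ℚ.<⇒≤ (ℚ.≰⇒> xN≰yN) ⟩
        seq x N                  ≤⟨ ∣p-q∣≤⇒q≤p+ (seq x n) (seq x N) (closeˣ n N≤n) ⟩
        seq x n + η              ∎))) y≮x

  p²≤q²⇒p≤q : ∀ {p q} → 0ℚ < q → p * p ≤ q * q → p ≤ q
  p²≤q²⇒p≤q {p} {q} 0<q p²≤q² = ℚ.≮⇒≥ λ q<p → ℚ.<-irrefl refl (begin-strict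
    q * q    <⟨ ℚ.*-monoʳ-<-pos q {{positive 0<q}} q<p ⟩
    q * p    ≤⟨ *-monoʳ p (ℚ.<⇒≤ (ℚ.<-trans 0<q q<p)) (ℚ.<⇒≤ q<p) ⟩
    p * p    ≤⟨ p²≤q² ⟩
    q * q    ∎)
    where open ℚ.≤-Reasoning

  p²≤q²⇒∣p∣≤q : ∀ {p q} → 0ℚ < q → p * p ≤ q * q → ∣ p ∣ ≤ q
  p²≤q²⇒∣p∣≤q {p} {q} 0<q p²≤q² = ∣p∣≤ (p²≤q²⇒p≤q 0<q p²≤q²)
    (p²≤q²⇒p≤q 0<q (subst (_≤ q * q) (sym (neg² p)) p²≤q²))
    where
    open +-*-Solver
    neg² : ∀ p → (- p) * (- p) ≡ p * p
    neg² = solve 1 (λ p → (:- p) :* (:- p) := p :* p) refl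

  -- The spectral radius of a non-negative matrix with constant row and column sums

  module ConstantSums {X : Set} (xs : List X) (_≟_ : DecidableEquality X) (complete : ∀ x → x ∈ xs)
    (A : X → X → ℤ) (D : ℕ) (0≤A : ∀ x y → 0ℤ ℤ.≤ A x y)
    (rows : ∀ x → Sum.∑ ℤ.+-*-rawRing xs (A x) ≡ ℤ.+ D)
    (columns : ∀ y → Sum.∑ ℤ.+-*-rawRing xs (λ x → A x y) ≡ ℤ.+ D) where

    open Matrices xs _≟_

    private
      a : X → X → ℚ
      a x y = ℤ→ℚ (A x y)

      D′ : ℚ
      D′ = ℕ→ℚ D

      0≤a : ∀ x y → 0ℚ ≤ a x y
      0≤a x y = subst (_≤ a x y) ℕ→ℚ-0 (ℤ→ℚ-mono-≤ (0≤A x y))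

      row-sums : ∀ x → ∑ℚ xs (a x) ≡ D′
      row-sums x = trans (sym (ℤ→ℚ-∑ xs (A x))) (cong ℤ→ℚ (rows x))

      column-sums : ∀ y → ∑ℚ xs (λ x → a x y) ≡ D′
      column-sums y = trans (sym (ℤ→ℚ-∑ xs (λ x → A x y))) (cong ℤ→ℚ (columns y))

      image : (X → ℂ) → X → ℂ
      image v x = ∑ℂ xs (λ y → ℤ→ℂ (A x y) *ᶜ v y)

      re-image : ∀ v x n → seq (re (image v x)) n ≡ ∑ℚ xs (λ y → a x y * seq (re (v y)) n)
      re-image v x n = trans (seq-re-∑ℂ xs (λ y → ℤ→ℂ (A x y) *ᶜ v y) n)
        (ℚ-∑.∑-cong xs (λ y → trans (cong (λ b → b * seq (re (v y)) n + - (0ℚ * seq (im (v y)) n)) (sym (ℤ→ℚ≡/1 (A x y))))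
          (drop (a x y * seq (re (v y)) n) (seq (im (v y)) n))))
        where
        open +-*-Solver
        drop : ∀ p i → p + - (0ℚ * i) ≡ p
        drop = solve 2 (λ p i → p :+ :- (con 0ℚ :* i) := p) refl

      im-image : ∀ v x n → seq (im (image v x)) n ≡ ∑ℚ xs (λ y → a x y * seq (im (v y)) n)
      im-image v x n = trans (seq-im-∑ℂ xs (λ y → ℤ→ℂ (A x y) *ᶜ v y) n)
        (ℚ-∑.∑-cong xs (λ y → trans (cong (λ b → b * seq (im (v y)) n + 0ℚ * seq (re (v y)) n) (sym (ℤ→ℚ≡/1 (A x y))))
          (drop (a x y * seq (im (v y)) n) (seq (re (v y)) n))))
        where
        open +-*-Solver
        drop : ∀ p i → p + 0ℚ * i ≡ p
        drop = solve 2 (λ p i → p :+ con 0ℚ :* i := p) refl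

      -- Norms are taken at one index `n` of the Cauchy sequences, where they are rational; this
      -- keeps Schur's test within ℚ.
      norm² : (X → ℂ) → ℕ → ℚ
      norm² v n = ∑ℚ xs (λ x → seq ∣ v x ∣² n)

      0≤∣∣² : ∀ z n → 0ℚ ≤ seq ∣ z ∣² n
      0≤∣∣² z n = 0≤+ (0≤p² (seq (re z) n)) (0≤p² (seq (im z) n))

      -- A real matrix acts on real and imaginary parts separately, so Schur's test is applied to
      -- each.
      norm²-image≤ : ∀ v n → norm² (image v) n ≤ D′ * D′ * norm² v n
      norm²-image≤ v n = begin
        ∑ℚ xs (λ x → seq ∣ image v x ∣² n)
          ≡⟨ ℚ-∑.∑-cong xs (λ x → cong₂ (λ p q → p * p + q * q) (re-image v x n) (im-image v x n)) ⟩
        ∑ℚ xs (λ x → lin r x * lin r x + lin i x * lin i x)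
          ≡⟨ ℚ-∑.∑-distrib-+ xs (λ x → lin r x * lin r x) (λ x → lin i x * lin i x) ⟩
        ∑ℚ xs (λ x → lin r x * lin r x) + ∑ℚ xs (λ x → lin i x * lin i x)
          ≤⟨ ℚ.+-mono-≤ (schur xs 0≤a row-sums column-sums (0≤ℕ→ℚ D) r)
                        (schur xs 0≤a row-sums column-sums (0≤ℕ→ℚ D) i) ⟩
        D′ * D′ * ∑ℚ xs (λ x → r x * r x) + D′ * D′ * ∑ℚ xs (λ x → i x * i x)
          ≡⟨ ℚ.*-distribˡ-+ (D′ * D′) (∑ℚ xs (λ x → r x * r x)) (∑ℚ xs (λ x → i x * i x)) ⟨
        D′ * D′ * (∑ℚ xs (λ x → r x * r x) + ∑ℚ xs (λ x → i x * i x))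
          ≡⟨ cong (D′ * D′ *_) (ℚ-∑.∑-distrib-+ xs (λ x → r x * r x) (λ x → i x * i x)) ⟨
        D′ * D′ * norm² v n ∎
        where
        open ℚ.≤-Reasoning
        r i : X → ℚ
        r x = seq (re (v x)) n
        i x = seq (im (v x)) n
        lin : (X → ℚ) → X → ℚ
        lin u x = ∑ℚ xs (λ y → a x y * u y)

      norm²-scale : ∀ z v n → norm² (λ x → z *ᶜ v x) n ≡ seq ∣ z ∣² n * norm² v n
      norm²-scale z v n = trans
        (ℚ-∑.∑-cong xs (λ x → multiplicative (seq (re z) n) (seq (im z) n) (seq (re (v x)) n) (seq (im (v x)) n)))
        (sym (ℚ-∑.*-distribˡ-∑ xs (seq ∣ z ∣² n) (λ x → seq ∣ v x ∣² n)))
        where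
        open +-*-Solver
        multiplicative : ∀ p q r i → (p * r + - (q * i)) * (p * r + - (q * i)) + (p * i + q * r) * (p * i + q * r) ≡
                         (p * p + q * q) * (r * r + i * i)
        multiplicative = solve 4 (λ p q r i →
          (p :* r :+ :- (q :* i)) :* (p :* r :+ :- (q :* i)) :+ (p :* i :+ q :* r) :* (p :* i :+ q :* r) :=
          (p :* p :+ q :* q) :* (r :* r :+ i :* i)) refl

      norm²-cong : ∀ {u v : X → ℂ} → (∀ x → u x ≈ᶜ v x) → ∀ ε → 0ℚ < ε →
                   ∃[ N ] ∀ n → N ℕ.≤ n → norm² v n ≤ norm² u n + ε
      norm²-cong {u} {v} u≈v ε 0<ε =
        let N , close = ∑ℝ-cong xs {λ x → ∣ u x ∣²} {λ x → ∣ v x ∣²} (λ x → ∣∣²-cong {u x} {v x} (u≈v x)) ε 0<ε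
        in N , λ n N≤n → subst₂ (λ p q → q ≤ p + ε) (seq-∑ℝ xs (λ x → ∣ u x ∣²) n) (seq-∑ℝ xs (λ x → ∣ v x ∣²) n)
             (∣p-q∣≤⇒q≤p+ (seq (∑ℝ xs (λ x → ∣ u x ∣²)) n) (seq (∑ℝ xs (λ x → ∣ v x ∣²)) n) (close n N≤n))

    ρ : ℝ
    ρ = fromℕ D

    private
      -- If D² + ε ≤ |z|² and A v = z v, then (D² + ε) ∥v∥² ≤ ∥A v∥² ≤ D² ∥v∥², so v = 0.
      large⇒zero : ∀ z v → ρ *ᴿ ρ <ᴿ ∣ z ∣² → (∀ x → image v x ≈ᶜ z *ᶜ v x) → ∀ δ → 0ℚ < δ →
                   ∃[ N ] ∀ n → N ℕ.≤ n → ∀ x → seq ∣ v x ∣² n ≤ δ * δ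
      large⇒zero z v (ε , 0<ε , N , gap) eigen δ 0<δ =
        -- The eigenvalue equation holds only up to equality of reals. The tolerance ε δ² leaves δ²
        -- once ε is cancelled.
        let M , close = norm²-cong {image v} {λ x → z *ᶜ v x} eigen (ε * (δ * δ)) (0<* 0<ε (0<* 0<δ 0<δ))
        in N ℕ.⊔ M , λ n ≤n x → ℚ.≤-trans (term≤∑ℚ (λ x → 0≤∣∣² (v x) n) (complete x))
          (ℚ.*-cancelˡ-≤-pos ε {{positive 0<ε}} (cancel (D′ * D′) (begin
            D′ * D′ * norm² v n + ε * norm² v n     ≡⟨ ℚ.*-distribʳ-+ (norm² v n) (D′ * D′) ε ⟨
            (D′ * D′ + ε) * norm² v n               ≤⟨ *-monoʳ (norm² v n) (0≤∑ℚ xs (λ x → 0≤∣∣² (v x) n))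
                                                         (subst (λ d → d * d + ε ≤ seq ∣ z ∣² n) (sym (ℤ→ℚ≡/1 (ℤ.+ D)))
                                                           (gap n (ℕ.m⊔n≤o⇒m≤o N M ≤n))) ⟩
            seq ∣ z ∣² n * norm² v n                ≡⟨ norm²-scale z v n ⟨
            norm² (λ x → z *ᶜ v x) n                ≤⟨ close n (ℕ.m⊔n≤o⇒n≤o N M ≤n) ⟩
            norm² (image v) n + ε * (δ * δ)         ≤⟨ ℚ.+-monoˡ-≤ (ε * (δ * δ)) (norm²-image≤ v n) ⟩
            D′ * D′ * norm² v n + ε * (δ * δ)       ∎)))
        where
        open ℚ.≤-Reasoning
        cancel : ∀ e {s p q} → e * s + p ≤ e * s + q → p ≤ q
        cancel e {s} {p} {q} le = subst₂ _≤_ (strip (e * s) p) (strip (e * s) q) (ℚ.+-monoʳ-≤ (- (e * s)) le)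
          where
          open +-*-Solver
          strip : ∀ a b → - a + (a + b) ≡ b
          strip = solve 2 (λ a b → :- a :+ (a :+ b) := b) refl

      ∣component∣≤ : ∀ p q {δ} → 0ℚ < δ → p * p + q * q ≤ δ * δ → ∣ p - 0ℚ ∣ ≤ δ × ∣ q - 0ℚ ∣ ≤ δ
      ∣component∣≤ p q {δ} 0<δ le =
        subst (λ x → ∣ x ∣ ≤ δ) (sym (ℚ.+-identityʳ p)) (p²≤q²⇒∣p∣≤q 0<δ (ℚ.≤-trans (p≤p+q (0≤p² q)) le)) ,
        subst (λ x → ∣ x ∣ ≤ δ) (sym (ℚ.+-identityʳ q)) (p²≤q²⇒∣p∣≤q 0<δ (ℚ.≤-trans (p≤q+p (0≤p² p)) le))

      -- That `v` is nonzero is a negative statement and supplies no component to divide by. So a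
      -- strict excess of |z|² is refuted, as it would force `v` to vanish.
      eigenvalue-bound : ∀ z → IsEigenvalue A z → ∣ z ∣² ≤ᴿ ρ *ᴿ ρ
      eigenvalue-bound z (v , v≉0 , eigen) = ≮ᴿ⇒≥ᴿ ∣ z ∣² (ρ *ᴿ ρ) λ large → v≉0 λ x →
        (λ δ 0<δ → let N , small = large⇒zero z v large eigen δ 0<δ in
          N , λ n N≤n → proj₁ (∣component∣≤ (seq (re (v x)) n) (seq (im (v x)) n) 0<δ (small n N≤n x))) ,
        (λ δ 0<δ → let N , small = large⇒zero z v large eigen δ 0<δ in
          N , λ n N≤n → proj₂ (∣component∣≤ (seq (re (v x)) n) (seq (im (v x)) n) 0<δ (small n N≤n x)))

      ρᶜ : ℂ
      ρᶜ = ρ +i fromℕ 0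

      ∑-constant : ∀ x {r : X → ℚ} {c} → (∀ y → r y ≡ c) → ∀ n → ∑ℚ xs (λ y → a x y * r y) ≡ seq ρ n * c
      ∑-constant x {c = c} r≡c n = trans (ℚ-∑.∑-cong xs (λ y → cong (a x y *_) (r≡c y)))
        (trans (sym (ℚ-∑.*-distribʳ-∑ xs c (a x))) (cong (_* c) (trans (row-sums x) (ℤ→ℚ≡/1 (ℤ.+ D)))))

      constant-eigen : ∀ v → (∀ y n → seq (re (v y)) n ≡ 1ℚ) → (∀ y n → seq (im (v y)) n ≡ 0ℚ) →
                       ∀ x → image v x ≈ᶜ ρᶜ *ᶜ v x
      constant-eigen v re≡1 im≡0 x =
        pointwise⇒≈ᴿ {re (image v x)} {re (ρᶜ *ᶜ v x)} (λ n → trans (re-image v x n)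
          (trans (∑-constant x (λ y → re≡1 y n) n) (re-product (seq ρ n) (seq (im (v x)) n) (re≡1 x n)))) ,
        pointwise⇒≈ᴿ {im (image v x)} {im (ρᶜ *ᶜ v x)} (λ n → trans (im-image v x n)
          (trans (∑-constant x (λ y → im≡0 y n) n) (im-product (seq ρ n) (seq (re (v x)) n) (im≡0 x n))))
        where
        re-product : ∀ d r {p q} → p ≡ q → d * q ≡ d * p + - (0ℚ * r)
        re-product d r {p} refl = sym (trans (cong (λ x → d * p + - x) (ℚ.*-zeroˡ r)) (ℚ.+-identityʳ (d * p)))
        im-product : ∀ d r {p q} → p ≡ q → d * q ≡ d * p + 0ℚ * r
        im-product d r {p} refl = sym (trans (cong (λ x → d * p + x) (ℚ.*-zeroˡ r)) (ℚ.+-identityʳ (d * p)))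

      ρᶜ-eigenvalue : X → IsEigenvalue A ρᶜ
      ρᶜ-eigenvalue x₀ = (λ _ → 1ᶜ) , 1≉0 , constant-eigen (λ _ → 1ᶜ) (λ _ _ → refl) (λ _ _ → refl)
        where
        1≉0 : ¬ (∀ (x : X) → 1ᶜ ≈ᶜ 0ᶜ)
        1≉0 1≈0 = let N , close = proj₁ (1≈0 x₀) ½ (ℚ.positive⁻¹ ½) in absurd (close N ℕ.≤-refl)
          where
          absurd : ¬ (∣ 1ℚ - 0ℚ ∣ ≤ ½)
          absurd (ℚ.*≤* (ℤ.+≤+ (ℕ.s≤s ())))

    spectralRadius : X → IsSpectralRadius A (fromℕ D)
    spectralRadius x₀ =
      (λ ε 0<ε → 0 , λ n _ → 0≤+ (subst (0ℚ ≤_) (ℤ→ℚ≡/1 (ℤ.+ D)) (0≤ℕ→ℚ D)) (ℚ.<⇒≤ 0<ε)) ,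
      (ρᶜ , ρᶜ-eigenvalue x₀ , pointwise⇒≈ᴿ {∣ ρᶜ ∣²} {ρ *ᴿ ρ} (λ n → ℚ.+-identityʳ (seq ρ n * seq ρ n))) ,
      eigenvalue-bound

open import Data.Integer using (+_) renaming (_≤_ to _≤ᶻ_)
open import Data.Nat using (ℕ; _≤_; _+_; _∸_)
open import Data.Product using (_×_; ∃-syntax)
open import Data.Rational using (_/_)
open import Data.Vec using (Vec; _++_)
import Data.Vec.Properties as Vec
open import Relation.Binary.PropositionalEquality using (_≡_; _≢_)

-- Connected regular graphs of positive degree

module _ (G : Graph) (d : ℕ) (connected : NonBacktracking.Connected G)
  (regular : NonBacktracking.Regular G d) (1≤d : 1 ≤ d) where

  open NonBacktracking G using (DirectedEdge; tail; directedEdges; Ev)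
  open Combinatorics
  open Analysis using (rootᴿ; roots; liminf-roots)

  someEdge : DirectedEdge
  someEdge = first (Fin.fromℕ< (ℕ.>-nonZero⁻¹ (Graph.∣V∣ G) {{proj₁ connected}}))
    where
    first : Fin (Graph.∣V∣ G) → DirectedEdge
    first v with filter (λ e → tail e Fin.≟ v) directedEdges | regular v
    ... | e ∷ _ | _    = e
    ... | []    | refl = contradiction 1≤d λ ()

  spectralRadius : ∀ b → b ≡ NonBacktracking.B G → NonBacktracking.IsSpectralRadius G b (fromℕ (d ∸ 1))
  spectralRadius _ refl = Analysis.ConstantSums.spectralRadius (NonBacktracking.directedEdges G)
    (NonBacktracking._≟ᴰ_ G) (ClosedWalks.directedEdges-complete G) (NonBacktracking.B G) (d ∸ 1)
    (0≤B G d regular) (row-sum G d regular) (column-sum G d regular) someEdge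
    where open RegularGraph

  -- The two premises together give d ≥ 3.
  growth : d ≢ 2 → 1 ≤ d ∸ 1 → ∃[ C ] ∀ n → (d ∸ 1) ℕ.^ n ≤ Ev ((C + n) + (C + n))
  growth d≢2 1≤D = Growth.growth G d regular connected
    (ℕ.≤∧≢⇒< (ℕ.≤-trans (ℕ.s≤s 1≤D) (ℕ.≤-reflexive (ℕ.m+[n∸m]≡n 1≤d))) (d≢2 ∘ sym)) someEdge

  -- The order of `rootᴿ` is its second argument plus one, so the number on the left is √(d - 1).
  liminf : d ≢ 2 → rootᴿ (d ∸ 1) 1 ≤liminfᵉᵛᵉⁿ roots Ev
  liminf d≢2 = liminf-roots Ev (d ∸ 1) (growth d≢2)

instance
  ≡-refl : {A : Set} {x : A} → x ≡ x
  ≡-refl = refl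

-- Comparing two occurrences of B inside ℝ normalises proofs of convergence.  Hence the
-- variable b; and b ≡ B is an instance so that b is first unified with the B of the goal.
walks-and-radius : (G : Graph) (d : ℕ) → let open NonBacktracking G in
    Connected → Regular d → (b : Matrix) → {{b ≡ NonBacktracking.B G}} →
    (∀ k → 1 ≤ k →
    ((w : Vec DirectedEdge k) → IsClosedNB w → IsClosedNB (w ++ w) × IsTotallyEven (w ++ w))
    ×
    ((w w′ : Vec DirectedEdge k) → IsClosedNB w → IsClosedNB w′ → w ++ w ≡ w′ ++ w′ → w ≡ w′)
    ×
    tr (b ^ᴹ k) ≤ᶻ + Ev (k + k))
    ×
    (1 ≤ d → ∃[ ρ ] IsSpectralRadius b ρ ×
    (∃[ s ] IsRoot 2 ρ s × IsRoot 2 (fromℕ (d ∸ 1)) s ×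
    (d ≢ 2 → ∃[ a ] (∀ ℓ → 1 ≤ ℓ → IsRoot ℓ (fromℕ (Ev ℓ)) (a ℓ)) × s ≤liminfᵉᵛᵉⁿ a)))
walks-and-radius G d connected regular b {{b≡B}} =
  (λ k 1≤k → (λ w closed → doubling-closed w 1≤k closed , doubling-even w) ,
             (λ w w′ _ _ → Vec.++-injectiveˡ w w′) ,
             subst (λ b → tr (b ^ᴹ k) ≤ᶻ + Ev (k + k)) (sym b≡B) (tr-B≤Ev k 1≤k)) ,
  λ 1≤d → fromℕ (d ∸ 1) , spectralRadius G d connected regular 1≤d b b≡B , rootᴿ (d ∸ 1) 1 ,
    rootᴿ-isRoot (d ∸ 1) 1 , rootᴿ-isRoot (d ∸ 1) 1 ,
    λ d≢2 → roots Ev , roots-isRoot Ev , liminf G d connected regular 1≤d d≢2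
  where
  open NonBacktracking G using (Ev; tr; _^ᴹ_)
  open Combinatorics.ClosedWalks G using (doubling-closed; doubling-even; tr-B≤Ev)
  open Analysis using (rootᴿ; rootᴿ-isRoot; roots; roots-isRoot)

proposition12 : (G : Graph) → let open NonBacktracking G in
    (d : ℕ) → Connected → Regular d →
    (∀ ℓ → 1 ≤ ℓ → + Ev ℓ / 1 ≡ 𝔼σ (λ σ → tr (Bσ σ ^ᴹ ℓ)))
    ×
    (∀ k → 1 ≤ k →
    ((w : Vec DirectedEdge k) → IsClosedNB w → IsClosedNB (w ++ w) × IsTotallyEven (w ++ w))
    ×
    ((w w′ : Vec DirectedEdge k) → IsClosedNB w → IsClosedNB w′ → w ++ w ≡ w′ ++ w′ → w ≡ w′)
    ×
    tr (B ^ᴹ k) ≤ᶻ + Ev (k + k))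
    ×
    (1 ≤ d → ∃[ ρ ] IsSpectralRadius B ρ ×
    (∃[ s ] IsRoot 2 ρ s × IsRoot 2 (fromℕ (d ∸ 1)) s ×
    (d ≢ 2 → ∃[ a ] (∀ ℓ → 1 ≤ ℓ → IsRoot ℓ (fromℕ (Ev ℓ)) (a ℓ)) × s ≤liminfᵉᵛᵉⁿ a)))
proposition12 G d connected regular =
  Combinatorics.ClosedWalks.Ev≡𝔼σ-tr G , walks-and-radius G d connected regular _
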